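{- For an integer $m\ge2$ let $S_m^4:=\{x_1^4+\cdots+x_m^4 : x_1,\dots,x_m\in\mathbb{Z}_{\ge0}\}$ and $R(S_m^4):=\{a/b: a,b\in S_m^4,\ b\neq0\}$. For all prime numbers $p>2$: (a) $R(S_2^4)$ is dense in $\mathbb{Q}_p$ if and only if $p\equiv1\pmod 8$. (b) $R(S_3^4)$ is dense in $\mathbb{Q}_p$ if and only if $p\neq5,29$. (c) $R(S_4^4)$ is dense in $\mathbb{Q}_p$ if and only if $p\neq5$. (d) $R(S_m^4)$ is dense in $\mathbb{Q}_p$ for all integers $m\ge5$. -}

module Defs where

open import Data.Nat as ℕ using (ℕ; _^_)
open import Data.Nat.Divisibility using (_∤_)
open import Data.Integer as ℤ using (ℤ; +_)
open import Data.Rational using (ℚ; _/_; _-_; _*_)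
open import Data.Vec using (Vec; map; sum)
open import Data.Product using (Σ; ∃; ∃-syntax; _×_)
open import Relation.Binary.PropositionalEquality using (_≡_; _≢_)

ℕ→ℚ : ℕ → ℚ
ℕ→ℚ n = (+ n) / 1

ℤ→ℚ : ℤ → ℚ
ℤ→ℚ z = z / 1

InS4 : ℕ → ℕ → Set
InS4 m n = Σ (Vec ℕ m) λ x → n ≡ sum (map (λ xi → xi ^ 4) x)

InRS4 : ℕ → ℚ → Set
InRS4 m r = ∃[ a ] ∃[ b ] (InS4 m a × InS4 m b × b ≢ 0 × r * ℕ→ℚ b ≡ ℕ→ℚ a)

-- y ∈ p^k ℤ_(p) ∩ ℚ, i.e. v_p(y) ≥ k (y = 0 included):
-- y · d = p^k · c for some integer c and natural d with p ∤ d
PAdicSmall : ℕ → ℕ → ℚ → Set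
PAdicSmall p k y = ∃[ c ] ∃[ d ] (p ∤ d × y * ℕ→ℚ d ≡ ℕ→ℚ (p ^ k) * ℤ→ℚ c)

-- A ⊆ ℚ is dense in ℚ_p. Since ℚ is dense in ℚ_p, this is equivalent to:
-- every rational x can be approximated p-adically to any order by elements of A.
DenseInQp : ℕ → (ℚ → Set) → Set
DenseInQp p A = (x : ℚ) (k : ℕ) → ∃[ r ] (A r × PAdicSmall p k (r - x))

{-# OPTIONS --safe #-}
-- If 1 + y₁⁴ + ⋯ + yₘ₋₁⁴ ≡ 0 (mod p) is solvable, Newton iteration makes x⁴ + y₁⁴ + ⋯ + yₘ₋₁⁴ p-adically
-- close to any prescribed multiple of p, so quotients of such sums approximate every rational.
-- If instead p divides a sum of m fourth powers only when it divides every term, then all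
-- valuations of such sums are multiples of 4, and p itself cannot be approximated.
-- For p ≡ 1 (mod 8), -1 is a fourth power.  For p ≡ 3 (mod 4), fourth powers are squares, and one of
-- them is followed by a nonsquare, that is, by the negative of a square.
-- For p ≡ 5 (mod 8) put p = 4f + 1 and ψ x = x ^ f, so that ψ x = 1 exactly on the nonzero fourth powers.
-- With A, B, C, D, E the numbers of y such that (ψ y, ψ (1 + y)) is (1, 1), (1, i), (1, -1), (1, -i), (-1, i),
-- a solution of 1 + a⁴ + b⁴ = 0 exists as soon as C ≠ 0.  Linear relations among these numbers and
-- the count of the solutions of 1 + b = c + d in fourth powers in two ways show that C = 0
-- forces 4E² ≤ 4E + 1 and p = 24E + 5, that is, p = 5 or p = 29.
module Submission where

open import Defs
import Algebra.Properties.CommutativeMonoid.Sum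
import Algebra.Properties.Semiring.Sum
import Algebra.Solver.Ring as RingSolver
open import Algebra.Bundles using (CommutativeRing)
open import Algebra.Solver.Ring.AlmostCommutativeRing using (fromCommutativeRing; _-Raw-AlmostCommutative⟶_)
open import Data.Fin as Fin using (Fin; toℕ; fromℕ<)
open import Data.Fin.Permutation using (permutation)
import Data.Fin.Properties as Finₚ
open import Data.Integer as ℤ using (ℤ; +_)
import Data.Integer.DivMod as ℤ
open import Data.Integer.Divisibility.Signed as ℤ using (divides)
import Data.Integer.Properties as ℤ
open import Data.Integer.Tactic.RingSolver using (solve-∀)
open import Data.List as List using (List; []; _∷_)
open import Data.List.Membership.DecPropositional using (_∈?_)
open import Data.List.Membership.Propositional using (_∈_)
open import Data.List.Relation.Unary.All as All using ([]; _∷_)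
open import Data.List.Relation.Unary.AllPairs using ([]; _∷_)
open import Data.List.Relation.Unary.Any using (here; there)
open import Data.List.Relation.Unary.Unique.Propositional using (Unique)
open import Data.Maybe using (Maybe; just; nothing)
open import Data.Nat using (ℕ; _<_; _≤_; _%_)
open import Data.Nat as ℕ using (zero; suc; NonZero; _+_; _*_; _∸_; _^_; z≤n; s≤s)
open import Data.Nat.Coprimality using (prime⇒coprime; coprime-Bézout)
import Data.Nat.DivMod as ℕ
import Data.Nat.Divisibility as ℕ
open import Data.Nat.GCD using (module Bézout)
import Data.Nat.Induction as ℕ
import Data.Nat.ListAction as ListAction
open import Data.Nat.Primality using (Prime; prime?; prime⇒nonZero; prime⇒nonTrivial; prime⇒irreducible; euclidsLemma)
import Data.Nat.Properties as ℕ
import Data.Nat.Tactic.RingSolver as ℕ-Ring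
open import Data.Product using (Σ; ∃-syntax; _×_; _,_; proj₁; proj₂)
open import Data.Rational as ℚ using (ℚ; ↥_; ↧ₙ_)
import Data.Rational.Properties as ℚ
import Data.Rational.Solver as ℚ
open import Data.Rational.Unnormalised as ℚᵘ using (*≡*)
import Data.Rational.Unnormalised.Properties as ℚᵘ
open import Data.Sum as Sum using (_⊎_; inj₁; inj₂)
open import Data.Vec using (Vec; []; _∷_; map; replicate; sum)
open import Data.Vec.Relation.Unary.All using (All; []; _∷_)
open import Function using (_∘_)
open import Function.Bundles using (_⇔_; mk⇔)
open import Induction.WellFounded using (Acc; acc)
open import Relation.Binary.PropositionalEquality using (_≡_; _≢_; refl; sym; trans; cong; cong₂; subst; module ≡-Reasoning; isEquivalence)
import Relation.Binary.Reasoning.Setoid as SetoidReasoning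
open import Relation.Nullary using (¬_; Dec; yes; no; contradiction)
open import Relation.Nullary.Decidable using (_×-dec_; _⊎-dec_; _→-dec_; from-yes)

-- The hard case is p ≡ 5 (mod 8). There ψ (-1) = (-1)^f = -1 because f is odd, so -1 is not a
-- fourth power and two terms cannot cancel. The same sign explains C: ψ (1 + y) = -1 says that -(1
-- + y) is a fourth power, so a y counted by C gives the zero 1 + y - (1 + y). No formula for such a
-- y is at hand, so its existence has to come from counting. Since ψ takes its values in the field
-- itself and every count is a natural number, the counting stays within finite sums. If C = 0, the
-- linear relations determine A, E and B + D from p and leave only B - D free. The quadratic
-- relation then fixes its square, (B - D)² = 1 + 4E - 4E², and a square is not negative. Both
-- surviving values of E are genuine exceptions: at 5 and 29 the absence of zeros is checked on the
-- residues of fourth powers. Density is phrased with rationals and finite precision, so Newton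
-- iteration runs on integers modulo powers of p, and p-adic valuations appear only as explicit
-- powers of p.

module PrimeField (p : ℕ) (p-prime : Prime p) where
  open ≡-Reasoning

  instance
    p-nonZero : NonZero p
    p-nonZero = prime⇒nonZero p-prime

  -- Residue classes modulo p.

  F : Set
  F = Fin p

  lift : F → ℤ
  lift x = + toℕ x

  infix 4 _≡ᵖ_

  -- A record, because the difference `a ℤ.- b` alone does not determine `a` and `b`, which are to
  -- be inferred from the type.
  record _≡ᵖ_ (a b : ℤ) : Set where
    constructor mod
    field ∣-difference : + p ℤ.∣ a ℤ.- b
  open _≡ᵖ_

  ≡ᵖ-sym : ∀ {a b} → a ≡ᵖ b → b ≡ᵖ a
  ≡ᵖ-sym {a} {b} (mod h) = mod (subst (+ p ℤ.∣_) (eq a b) (ℤ.∣m⇒∣-m h))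
    where
    eq : ∀ a b → ℤ.- (a ℤ.- b) ≡ b ℤ.- a
    eq = solve-∀

  ≡ᵖ-trans : ∀ {a b c} → a ≡ᵖ b → b ≡ᵖ c → a ≡ᵖ c
  ≡ᵖ-trans {a} {b} {c} (mod h) (mod k) = mod (subst (+ p ℤ.∣_) (eq a b c) (ℤ.∣m∣n⇒∣m+n h k))
    where
    eq : ∀ a b c → (a ℤ.- b) ℤ.+ (b ℤ.- c) ≡ a ℤ.- c
    eq = solve-∀

  abstract
    ι : ℤ → F
    ι a = fromℕ< (ℤ.n%ℕd<d a p)

    lift-ι : ∀ a → lift (ι a) ≡ᵖ a
    lift-ι a rewrite Finₚ.toℕ-fromℕ< (ℤ.n%ℕd<d a p) = mod (divides (ℤ.- q) (begin
      + r ℤ.- a                       ≡⟨ cong (λ t → + r ℤ.- t) (ℤ.a≡a%ℕn+[a/ℕn]*n a p) ⟩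
      + r ℤ.- (+ r ℤ.+ q ℤ.* + p)     ≡⟨ eq (+ r) q (+ p) ⟩
      ℤ.- q ℤ.* + p                   ∎))
      where
      r : ℕ
      r = a ℤ.%ℕ p
      q : ℤ
      q = a ℤ./ℕ p
      eq : ∀ r q n → r ℤ.- (r ℤ.+ q ℤ.* n) ≡ ℤ.- q ℤ.* n
      eq = solve-∀

  -- Representatives lie in [0, p), so their difference has absolute value below p, and p divides it
  -- only if it is zero.
  lift-injective : ∀ {x y} → lift x ≡ᵖ lift y → x ≡ y
  lift-injective {x} {y} (mod h) = Finₚ.toℕ-injective (ℤ.+-injective
    (ℤ.i-j≡0⇒i≡j _ _ (ℤ.∣i∣≡0⇒i≡0 (small⇒0 (ℤ.∣⇒∣ᵤ h) bound))))
    where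
    small⇒0 : ∀ {n} → p ℕ.∣ n → n < p → n ≡ 0
    small⇒0 {zero}  _ _ = refl
    small⇒0 {suc n} d l = contradiction (ℕ.∣⇒≤ d) (ℕ.<⇒≱ l)
    bound : ℤ.∣ lift x ℤ.- lift y ∣ < p
    bound = ℕ.≤-<-trans
      (ℕ.≤-trans (ℕ.≤-reflexive (cong ℤ.∣_∣ (ℤ.m-n≡m⊖n (toℕ x) (toℕ y)))) (ℤ.∣m⊝n∣≤m⊔n (toℕ x) (toℕ y)))
      (ℕ.⊔-lub (Finₚ.toℕ<n x) (Finₚ.toℕ<n y))

  ι-cong : ∀ {a b} → a ≡ᵖ b → ι a ≡ ι b
  ι-cong {a} {b} h = lift-injective (≡ᵖ-trans (lift-ι a) (≡ᵖ-trans h (≡ᵖ-sym (lift-ι b))))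

  ι-injective : ∀ {a b} → ι a ≡ ι b → a ≡ᵖ b
  ι-injective {a} {b} h = ≡ᵖ-trans (≡ᵖ-sym (lift-ι a)) (subst (λ x → lift x ≡ᵖ b) (sym h) (lift-ι b))

  ι-lift : ∀ x → ι (lift x) ≡ x
  ι-lift x = lift-injective (lift-ι (lift x))

  -- The ring structure inherited from the integers.

  infixl 6 _+ᶠ_ _-ᶠ_
  infixl 7 _*ᶠ_
  infix 8 -ᶠ_

  abstract
    _+ᶠ_ _*ᶠ_ : F → F → F
    x +ᶠ y = ι (lift x ℤ.+ lift y)
    x *ᶠ y = ι (lift x ℤ.* lift y)

    -ᶠ_ : F → F
    -ᶠ x = ι (ℤ.- lift x)

    0ᶠ 1ᶠ : F
    0ᶠ = ι (+ 0)
    1ᶠ = ι (+ 1)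

    ι-+ : ∀ a b → ι (a ℤ.+ b) ≡ ι a +ᶠ ι b
    ι-+ a b = sym (ι-cong {lift (ι a) ℤ.+ lift (ι b)} {a ℤ.+ b} (mod (subst (+ p ℤ.∣_) (eq (lift (ι a)) (lift (ι b)) a b)
      (ℤ.∣m∣n⇒∣m+n (∣-difference (lift-ι a)) (∣-difference (lift-ι b))))))
      where
      eq : ∀ x y a b → (x ℤ.- a) ℤ.+ (y ℤ.- b) ≡ (x ℤ.+ y) ℤ.- (a ℤ.+ b)
      eq = solve-∀

    ι-* : ∀ a b → ι (a ℤ.* b) ≡ ι a *ᶠ ι b
    ι-* a b = sym (ι-cong {lift (ι a) ℤ.* lift (ι b)} {a ℤ.* b} (mod (subst (+ p ℤ.∣_) (eq (lift (ι a)) (lift (ι b)) a b)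
      (ℤ.∣m∣n⇒∣m+n (ℤ.∣m⇒∣m*n (lift (ι b)) (∣-difference (lift-ι a))) (ℤ.∣m⇒∣m*n a (∣-difference (lift-ι b)))))))
      where
      eq : ∀ x y a b → (x ℤ.- a) ℤ.* y ℤ.+ (y ℤ.- b) ℤ.* a ≡ x ℤ.* y ℤ.- a ℤ.* b
      eq = solve-∀

    ι-neg : ∀ a → ι (ℤ.- a) ≡ -ᶠ ι a
    ι-neg a = sym (ι-cong {ℤ.- lift (ι a)} {ℤ.- a} (mod (subst (+ p ℤ.∣_) (eq (lift (ι a)) a) (ℤ.∣m⇒∣-m (∣-difference (lift-ι a))))))
      where
      eq : ∀ x a → ℤ.- (x ℤ.- a) ≡ ℤ.- x ℤ.- ℤ.- a
      eq = solve-∀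

    ι-0 : ι (+ 0) ≡ 0ᶠ
    ι-0 = refl

    ι-1 : ι (+ 1) ≡ 1ᶠ
    ι-1 = refl

    -- Every law of ℤ descends along the surjective homomorphism ι.
    +ᶠ-assoc : ∀ x y z → (x +ᶠ y) +ᶠ z ≡ x +ᶠ (y +ᶠ z)
    +ᶠ-assoc x y z = begin
      ι a +ᶠ z            ≡⟨ cong (ι a +ᶠ_) (sym (ι-lift z)) ⟩
      ι a +ᶠ ι (lift z)   ≡⟨ sym (ι-+ a (lift z)) ⟩
      ι (a ℤ.+ lift z)    ≡⟨ cong ι (ℤ.+-assoc (lift x) (lift y) (lift z)) ⟩
      ι (lift x ℤ.+ b)    ≡⟨ ι-+ (lift x) b ⟩
      ι (lift x) +ᶠ ι b   ≡⟨ cong (_+ᶠ ι b) (ι-lift x) ⟩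
      x +ᶠ ι b            ∎
      where
      a b : ℤ
      a = lift x ℤ.+ lift y
      b = lift y ℤ.+ lift z

    *ᶠ-assoc : ∀ x y z → (x *ᶠ y) *ᶠ z ≡ x *ᶠ (y *ᶠ z)
    *ᶠ-assoc x y z = begin
      ι a *ᶠ z            ≡⟨ cong (ι a *ᶠ_) (sym (ι-lift z)) ⟩
      ι a *ᶠ ι (lift z)   ≡⟨ sym (ι-* a (lift z)) ⟩
      ι (a ℤ.* lift z)    ≡⟨ cong ι (ℤ.*-assoc (lift x) (lift y) (lift z)) ⟩
      ι (lift x ℤ.* b)    ≡⟨ ι-* (lift x) b ⟩
      ι (lift x) *ᶠ ι b   ≡⟨ cong (_*ᶠ ι b) (ι-lift x) ⟩
      x *ᶠ ι b            ∎
      where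
      a b : ℤ
      a = lift x ℤ.* lift y
      b = lift y ℤ.* lift z

    +ᶠ-comm : ∀ x y → x +ᶠ y ≡ y +ᶠ x
    +ᶠ-comm x y = cong ι (ℤ.+-comm (lift x) (lift y))

    *ᶠ-comm : ∀ x y → x *ᶠ y ≡ y *ᶠ x
    *ᶠ-comm x y = cong ι (ℤ.*-comm (lift x) (lift y))

    +ᶠ-identityˡ : ∀ x → 0ᶠ +ᶠ x ≡ x
    +ᶠ-identityˡ x = begin
      ι (+ 0) +ᶠ x             ≡⟨ cong (ι (+ 0) +ᶠ_) (sym (ι-lift x)) ⟩
      ι (+ 0) +ᶠ ι (lift x)    ≡⟨ sym (ι-+ (+ 0) (lift x)) ⟩
      ι (+ 0 ℤ.+ lift x)       ≡⟨ cong ι (ℤ.+-identityˡ (lift x)) ⟩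
      ι (lift x)               ≡⟨ ι-lift x ⟩
      x                        ∎

    *ᶠ-identityˡ : ∀ x → 1ᶠ *ᶠ x ≡ x
    *ᶠ-identityˡ x = begin
      ι (+ 1) *ᶠ x             ≡⟨ cong (ι (+ 1) *ᶠ_) (sym (ι-lift x)) ⟩
      ι (+ 1) *ᶠ ι (lift x)    ≡⟨ sym (ι-* (+ 1) (lift x)) ⟩
      ι (+ 1 ℤ.* lift x)       ≡⟨ cong ι (ℤ.*-identityˡ (lift x)) ⟩
      ι (lift x)               ≡⟨ ι-lift x ⟩
      x                        ∎

    -ᶠ-inverseˡ : ∀ x → -ᶠ x +ᶠ x ≡ 0ᶠ
    -ᶠ-inverseˡ x = begin
      ι (ℤ.- lift x) +ᶠ x             ≡⟨ cong (ι (ℤ.- lift x) +ᶠ_) (sym (ι-lift x)) ⟩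
      ι (ℤ.- lift x) +ᶠ ι (lift x)    ≡⟨ sym (ι-+ (ℤ.- lift x) (lift x)) ⟩
      ι (ℤ.- lift x ℤ.+ lift x)       ≡⟨ cong ι (ℤ.+-inverseˡ (lift x)) ⟩
      0ᶠ                              ∎

    *ᶠ-distribˡ : ∀ x y z → x *ᶠ (y +ᶠ z) ≡ x *ᶠ y +ᶠ x *ᶠ z
    *ᶠ-distribˡ x y z = begin
      x *ᶠ ι a                                  ≡⟨ cong (_*ᶠ ι a) (sym (ι-lift x)) ⟩
      ι (lift x) *ᶠ ι a                         ≡⟨ sym (ι-* (lift x) a) ⟩
      ι (lift x ℤ.* a)                          ≡⟨ cong ι (ℤ.*-distribˡ-+ (lift x) (lift y) (lift z)) ⟩
      ι (lift x ℤ.* lift y ℤ.+ lift x ℤ.* lift z) ≡⟨ ι-+ (lift x ℤ.* lift y) (lift x ℤ.* lift z) ⟩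
      x *ᶠ y +ᶠ x *ᶠ z                          ∎
      where
      a : ℤ
      a = lift y ℤ.+ lift z

  commutativeRing : CommutativeRing _ _
  commutativeRing = record
    { Carrier = F ; _≈_ = _≡_ ; _+_ = _+ᶠ_ ; _*_ = _*ᶠ_ ; -_ = -ᶠ_ ; 0# = 0ᶠ ; 1# = 1ᶠ
    ; isCommutativeRing = record
      { isRing = record
        { +-isAbelianGroup = record
          { isGroup = record
            { isMonoid = record
              { isSemigroup = record
                { isMagma = record { isEquivalence = isEquivalence ; ∙-cong = cong₂ _+ᶠ_ }
                ; assoc = +ᶠ-assoc }
              ; identity = +ᶠ-identityˡ , λ x → trans (+ᶠ-comm x 0ᶠ) (+ᶠ-identityˡ x) }
            ; inverse = -ᶠ-inverseˡ , λ x → trans (+ᶠ-comm x (-ᶠ x)) (-ᶠ-inverseˡ x)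
            ; ⁻¹-cong = cong -ᶠ_ }
          ; comm = +ᶠ-comm }
        ; *-cong = cong₂ _*ᶠ_
        ; *-assoc = *ᶠ-assoc
        ; *-identity = *ᶠ-identityˡ , λ x → trans (*ᶠ-comm x 1ᶠ) (*ᶠ-identityˡ x)
        ; distrib = *ᶠ-distribˡ , λ x y z → trans (*ᶠ-comm (y +ᶠ z) x)
            (trans (*ᶠ-distribˡ x y z) (cong₂ _+ᶠ_ (*ᶠ-comm x y) (*ᶠ-comm x z))) }
      ; *-comm = *ᶠ-comm } }

  open CommutativeRing commutativeRing public
    using (*-commutativeMonoid; commutativeSemiring)
    renaming (semiring to semiringᶠ; *-identityʳ to *ᶠ-identityʳ; +-identityʳ to +ᶠ-identityʳ; zeroˡ to *ᶠ-zeroˡ; zeroʳ to *ᶠ-zeroʳ; -‿inverseʳ to -ᶠ-inverseʳ)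
  open import Algebra.Properties.Semiring.Exp semiringᶠ public
    using () renaming (_^_ to _^ᶠ_; ^-homo-* to ^ᶠ-homo-*; ^-assocʳ to ^ᶠ-assocʳ)
  open import Algebra.Properties.CommutativeSemiring.Exp commutativeSemiring public
    using () renaming (^-distrib-* to ^ᶠ-distrib-*)

  _-ᶠ_ : F → F → F
  x -ᶠ y = x +ᶠ -ᶠ y

  ι-morphism : CommutativeRing.rawRing ℤ.+-*-commutativeRing -Raw-AlmostCommutative⟶ fromCommutativeRing commutativeRing
  ι-morphism = record { ⟦_⟧ = ι ; +-homo = ι-+ ; *-homo = ι-* ; -‿homo = ι-neg ; 0-homo = ι-0 ; 1-homo = ι-1 }

  coeff≟ : ∀ a b → Maybe (ι a ≡ ι b)
  coeff≟ a b with a ℤ.≟ b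
  ... | yes eq = just (cong ι eq)
  ... | no _   = nothing

  module Solver = RingSolver _ _ ι-morphism coeff≟
  open Solver public using (solve; _:=_; _:+_; _:*_; _:-_; :-_; con)

  -- Zero divisors and inverses.

  ι-≡0⇒∣ : ∀ {a} → ι a ≡ 0ᶠ → + p ℤ.∣ a
  ι-≡0⇒∣ {a} h = subst (+ p ℤ.∣_) (ℤ.+-identityʳ a) (∣-difference (ι-injective (trans h (sym ι-0))))

  ∣⇒ι-≡0 : ∀ {a} → + p ℤ.∣ a → ι a ≡ 0ᶠ
  ∣⇒ι-≡0 {a} h = trans (ι-cong (mod (subst (+ p ℤ.∣_) (sym (ℤ.+-identityʳ a)) h))) ι-0

  1≢0 : 1ᶠ ≢ 0ᶠ
  1≢0 h = ℕ.nonTrivial⇒≢1 {{prime⇒nonTrivial p-prime}} (ℕ.∣1⇒≡1 (ℤ.∣⇒∣ᵤ (ι-≡0⇒∣ {+ 1} (trans ι-1 h))))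

  zeroProduct : ∀ x y → x *ᶠ y ≡ 0ᶠ → x ≡ 0ᶠ ⊎ y ≡ 0ᶠ
  zeroProduct x y h = Sum.map (≡0 x) (≡0 y) (euclidsLemma (toℕ x) (toℕ y) p-prime p∣xy)
    where
    ≡0 : ∀ x → p ℕ.∣ toℕ x → x ≡ 0ᶠ
    ≡0 x d = trans (sym (ι-lift x)) (∣⇒ι-≡0 (ℤ.∣ᵤ⇒∣ d))
    p∣xy : p ℕ.∣ toℕ x * toℕ y
    p∣xy = subst (p ℕ.∣_) (ℤ.abs-* (lift x) (lift y)) (ℤ.∣⇒∣ᵤ (ι-≡0⇒∣
      (trans (ι-* (lift x) (lift y)) (trans (cong₂ _*ᶠ_ (ι-lift x) (ι-lift y)) h))))

  *ᶠ-≢0 : ∀ {x y} → x ≢ 0ᶠ → y ≢ 0ᶠ → x *ᶠ y ≢ 0ᶠ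
  *ᶠ-≢0 {x} {y} x≢0 y≢0 h = Sum.[ x≢0 , y≢0 ]′ (zeroProduct x y h)

  ^ᶠ-≢0 : ∀ {x} n → x ≢ 0ᶠ → x ^ᶠ n ≢ 0ᶠ
  ^ᶠ-≢0 zero    x≢0 = 1≢0
  ^ᶠ-≢0 (suc n) x≢0 = *ᶠ-≢0 x≢0 (^ᶠ-≢0 n x≢0)

  0^ᶠ : ∀ n → .{{NonZero n}} → 0ᶠ ^ᶠ n ≡ 0ᶠ
  0^ᶠ (suc n) = *ᶠ-zeroˡ _

  1^ᶠ : ∀ n → 1ᶠ ^ᶠ n ≡ 1ᶠ
  1^ᶠ zero    = refl
  1^ᶠ (suc n) = trans (*ᶠ-identityˡ _) (1^ᶠ n)

  -ᶠ-≡0⇒≡ : ∀ {x y} → x -ᶠ y ≡ 0ᶠ → x ≡ y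
  -ᶠ-≡0⇒≡ {x} {y} h = begin
    x              ≡⟨ solve 2 (λ x y → x := (x :- y) :+ y) refl x y ⟩
    (x -ᶠ y) +ᶠ y  ≡⟨ cong (_+ᶠ y) h ⟩
    0ᶠ +ᶠ y        ≡⟨ +ᶠ-identityˡ y ⟩
    y              ∎

  *ᶠ-cancelʳ : ∀ {x y z} → z ≢ 0ᶠ → x *ᶠ z ≡ y *ᶠ z → x ≡ y
  *ᶠ-cancelʳ {x} {y} {z} z≢0 h =
    Sum.[ -ᶠ-≡0⇒≡ , (λ z≡0 → contradiction z≡0 z≢0) ]′ (zeroProduct (x -ᶠ y) z (begin
      (x -ᶠ y) *ᶠ z       ≡⟨ solve 3 (λ x y z → (x :- y) :* z := x :* z :- y :* z) refl x y z ⟩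
      x *ᶠ z -ᶠ y *ᶠ z    ≡⟨ cong (_-ᶠ y *ᶠ z) h ⟩
      y *ᶠ z -ᶠ y *ᶠ z    ≡⟨ -ᶠ-inverseʳ _ ⟩
      0ᶠ                  ∎))

  -- Modulo p, a Bézout identity between p and the representative n of x makes the coefficient of n
  -- an inverse of x up to sign. Over the naturals the identity has two forms, 1 + b n = a p and 1 +
  -- a p = b n, hence the two cases.
  inverse : ∀ x → x ≢ 0ᶠ → ∃[ y ] x *ᶠ y ≡ 1ᶠ
  inverse x x≢0 = from-Bézout (coprime-Bézout (prime⇒coprime p-prime {{toℕ-nonZero}} (Finₚ.toℕ<n x)))
    where
    n = toℕ x
    toℕ-nonZero : NonZero n
    toℕ-nonZero = ℕ.≢-nonZero λ n≡0 → x≢0 (trans (sym (ι-lift x)) (trans (cong (ι ∘ +_) n≡0) ι-0))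
    from-Bézout : Bézout.Identity 1 p n → ∃[ y ] x *ᶠ y ≡ 1ᶠ
    from-Bézout (Bézout.+- a b eq) = ι (ℤ.- + b) , (begin
      x *ᶠ ι (ℤ.- + b)             ≡⟨ cong (_*ᶠ ι (ℤ.- + b)) (sym (ι-lift x)) ⟩
      ι (+ n) *ᶠ ι (ℤ.- + b)       ≡⟨ sym (ι-* (+ n) (ℤ.- + b)) ⟩
      ι (+ n ℤ.* ℤ.- + b)          ≡⟨ ι-cong (mod (divides (ℤ.- + a) (trans (shape (+ n) (+ b)) (trans (cong ℤ.-_ eqℤ) (ℤ.neg-distribˡ-* (+ a) (+ p)))))) ⟩
      ι (+ 1)                      ≡⟨ ι-1 ⟩
      1ᶠ                           ∎)
      where
      shape : ∀ n b → n ℤ.* ℤ.- b ℤ.- + 1 ≡ ℤ.- (+ 1 ℤ.+ b ℤ.* n)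
      shape = solve-∀
      eqℤ : + 1 ℤ.+ + b ℤ.* + n ≡ + a ℤ.* + p
      eqℤ = trans (cong (λ t → + 1 ℤ.+ t) (sym (ℤ.pos-* b n))) (trans (cong +_ eq) (ℤ.pos-* a p))
    from-Bézout (Bézout.-+ a b eq) = ι (+ b) , (begin
      x *ᶠ ι (+ b)                 ≡⟨ cong (_*ᶠ ι (+ b)) (sym (ι-lift x)) ⟩
      ι (+ n) *ᶠ ι (+ b)           ≡⟨ sym (ι-* (+ n) (+ b)) ⟩
      ι (+ n ℤ.* + b)              ≡⟨ ι-cong (mod (divides (+ a) (trans (cong (ℤ._- + 1) (trans (ℤ.*-comm (+ n) (+ b)) (sym eqℤ))) (shape (+ a ℤ.* + p))))) ⟩
      ι (+ 1)                      ≡⟨ ι-1 ⟩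
      1ᶠ                           ∎)
      where
      shape : ∀ n → + 1 ℤ.+ n ℤ.- + 1 ≡ n
      shape = solve-∀
      eqℤ : + 1 ℤ.+ + a ℤ.* + p ≡ + b ℤ.* + n
      eqℤ = trans (cong (λ t → + 1 ℤ.+ t) (sym (ℤ.pos-* a p))) (trans (cong +_ eq) (ℤ.pos-* b n))

  *ᶠ-inverse-cancel : ∀ {a b} → a *ᶠ b ≡ 1ᶠ → ∀ x → a *ᶠ (b *ᶠ x) ≡ x
  *ᶠ-inverse-cancel {a} {b} ab≡1 x = trans (sym (*ᶠ-assoc a b x)) (trans (cong (_*ᶠ x) ab≡1) (*ᶠ-identityˡ x))

  -- Fermat's little theorem.

  module ∏ = Algebra.Properties.CommutativeMonoid.Sum *-commutativeMonoid

  ∏-≢0 : ∀ {n} (t : Fin n → F) → (∀ i → t i ≢ 0ᶠ) → ∏.sum t ≢ 0ᶠ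
  ∏-≢0 {zero}  t t≢0 = 1≢0
  ∏-≢0 {suc n} t t≢0 = *ᶠ-≢0 (t≢0 Fin.zero) (∏-≢0 (t ∘ Fin.suc) (t≢0 ∘ Fin.suc))

  -- Setting the value at `0ᶠ` to `1ᶠ` lets a product over the nonzero elements be taken over all of
  -- `Fin p`.
  _except_at_ : ∀ {n} → (Fin n → F) → F → Fin n → Fin n → F
  (t except u at i) j with j Finₚ.≟ i
  ... | yes _ = u
  ... | no _  = t j

  except-≢ : ∀ {n} (t : Fin n → F) {u i j} → j ≢ i → (t except u at i) j ≡ t j
  except-≢ t {u} {i} {j} j≢i with j Finₚ.≟ i
  ... | yes j≡i = contradiction j≡i j≢i
  ... | no _    = refl

  except-≡ : ∀ {n} (t : Fin n → F) {u i} → (t except u at i) i ≡ u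
  except-≡ t {u} {i} with i Finₚ.≟ i
  ... | yes _  = refl
  ... | no i≢i = contradiction refl i≢i

  ∏-const-except : ∀ {n} u (i : Fin n) → ∏.sum ((λ _ → u) except 1ᶠ at i) ≡ u ^ᶠ (n ∸ 1)
  ∏-const-except {suc n} u i = begin
    ∏.sum t                          ≡⟨ ∏.sum-remove {i = i} t ⟩
    t i *ᶠ ∏.sum (t ∘ Fin.punchIn i) ≡⟨ cong₂ _*ᶠ_ (except-≡ (λ _ → u) {i = i}) (∏.sum-cong-≗ (λ j → except-≢ (λ _ → u) (Finₚ.punchInᵢ≢i i j))) ⟩
    1ᶠ *ᶠ ∏.sum {n} (λ _ → u)        ≡⟨ *ᶠ-identityˡ _ ⟩
    ∏.sum {n} (λ _ → u)              ≡⟨ ∏.sum-replicate n ⟩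
    u ^ᶠ n                           ∎
    where
    t = (λ _ → u) except 1ᶠ at i

  -- Multiplication by u permutes the nonzero elements, so their product equals u^(p - 1) times
  -- itself and can be cancelled.
  fermat : ∀ {u} → u ≢ 0ᶠ → u ^ᶠ (p ∸ 1) ≡ 1ᶠ
  fermat {u} u≢0 = *ᶠ-cancelʳ (∏-≢0 φ φ≢0) (begin
    u ^ᶠ (p ∸ 1) *ᶠ ∏.sum φ          ≡⟨ cong (_*ᶠ ∏.sum φ) (sym (∏-const-except u 0ᶠ)) ⟩
    ∏.sum υ *ᶠ ∏.sum φ               ≡⟨ sym (∏.∑-distrib-+ υ φ) ⟩
    ∏.sum (λ x → υ x *ᶠ φ x)         ≡⟨ ∏.sum-cong-≗ (sym ∘ scale) ⟩
    ∏.sum (λ x → φ (u *ᶠ x))         ≡⟨ sym (∏.sum-permute φ (permutation (u *ᶠ_) (v *ᶠ_) (*ᶠ-inverse-cancel uv≡1) (*ᶠ-inverse-cancel (trans (*ᶠ-comm v u) uv≡1)))) ⟩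
    ∏.sum φ                          ≡⟨ sym (*ᶠ-identityˡ _) ⟩
    1ᶠ *ᶠ ∏.sum φ                    ∎)
    where
    v = proj₁ (inverse u u≢0)
    uv≡1 = proj₂ (inverse u u≢0)
    φ υ : F → F
    φ = (λ x → x) except 1ᶠ at 0ᶠ
    υ = (λ _ → u) except 1ᶠ at 0ᶠ
    φ≢0 : ∀ x → φ x ≢ 0ᶠ
    φ≢0 x with x Finₚ.≟ 0ᶠ
    ... | yes _  = 1≢0
    ... | no x≢0 = x≢0
    -- At x = 0 both sides are 1, because `φ` and `υ` are both modified there.
    scale : ∀ x → φ (u *ᶠ x) ≡ υ x *ᶠ φ x
    scale x with x Finₚ.≟ 0ᶠ
    ... | no x≢0   = except-≢ (λ x → x) (*ᶠ-≢0 u≢0 x≢0)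
    ... | yes refl = trans (cong φ (*ᶠ-zeroʳ u)) (trans (except-≡ (λ x → x) {i = 0ᶠ}) (sym (*ᶠ-identityˡ 1ᶠ)))

  -- Monic polynomials and the number of their roots.

  -- The vector (a₀, …, aₙ₋₁) stands for the monic polynomial a₀ + a₁X + ⋯ + aₙ₋₁Xⁿ⁻¹ + Xⁿ.
  eval : ∀ {n} → Vec F n → F → F
  eval []       x = 1ᶠ
  eval (a ∷ as) x = a +ᶠ x *ᶠ eval as x

  -- Synthetic division by X - r: the coefficients of the quotient are the Horner values at r, and
  -- the quotient is again monic.
  quotient : ∀ {n} → Vec F (suc n) → F → Vec F n
  quotient (a ∷ [])      r = []
  quotient (a ∷ b ∷ as)  r = eval (b ∷ as) r ∷ quotient (b ∷ as) r

  eval-quotient : ∀ {n} (as : Vec F (suc n)) r x →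
                  eval as x -ᶠ eval as r ≡ (x -ᶠ r) *ᶠ eval (quotient as r) x
  eval-quotient (a ∷ []) r x =
    solve 4 (λ a r x u → (a :+ x :* u) :- (a :+ r :* u) := (x :- r) :* u) refl a r x 1ᶠ
  eval-quotient (a ∷ as@(_ ∷ _)) r x = begin
    (a +ᶠ x *ᶠ e) -ᶠ (a +ᶠ r *ᶠ d)        ≡⟨ solve 5 (λ a x e r d → (a :+ x :* e) :- (a :+ r :* d) := x :* (e :- d) :+ (x :- r) :* d) refl a x e r d ⟩
    x *ᶠ (e -ᶠ d) +ᶠ (x -ᶠ r) *ᶠ d        ≡⟨ cong (λ t → x *ᶠ t +ᶠ (x -ᶠ r) *ᶠ d) (eval-quotient as r x) ⟩
    x *ᶠ ((x -ᶠ r) *ᶠ q) +ᶠ (x -ᶠ r) *ᶠ d ≡⟨ solve 4 (λ x y q d → x :* (y :* q) :+ y :* d := y :* (d :+ x :* q)) refl x (x -ᶠ r) q d ⟩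
    (x -ᶠ r) *ᶠ (d +ᶠ x *ᶠ q)             ∎
    where
    e = eval as x
    d = eval as r
    q = eval (quotient as r) x

  -- Dividing by X - r for one root r lowers the degree, and the other roots remain roots of the
  -- quotient since there are no zero divisors. In degree 0 the polynomial is the constant 1.
  few-roots : ∀ {n} (as : Vec F n) (ρ : Fin (suc n) → F) → (∀ {i j} → ρ i ≡ ρ j → i ≡ j) →
              ¬ (∀ i → eval as (ρ i) ≡ 0ᶠ)
  few-roots {zero}  []  ρ ρ-inj root = 1≢0 (root Fin.zero)
  few-roots {suc n} as  ρ ρ-inj root = few-roots q (ρ ∘ Fin.suc) (λ eq → Finₚ.suc-injective (ρ-inj eq)) root′
    where
    r : F
    r = ρ Fin.zero
    q : Vec F n
    q = quotient as r
    distinct : ∀ i → ρ (Fin.suc i) -ᶠ r ≢ 0ᶠ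
    distinct i eq = Finₚ.0≢1+n (sym (ρ-inj (-ᶠ-≡0⇒≡ eq)))
    root′ : ∀ i → eval q (ρ (Fin.suc i)) ≡ 0ᶠ
    root′ i = Sum.[ (λ eq → contradiction eq (distinct i)) , (λ eq → eq) ]′ (zeroProduct (x -ᶠ r) (eval q x) (begin
      (x -ᶠ r) *ᶠ eval q x    ≡⟨ sym (eval-quotient as r x) ⟩
      eval as x -ᶠ eval as r  ≡⟨ cong₂ _-ᶠ_ (root (Fin.suc i)) (root Fin.zero) ⟩
      0ᶠ -ᶠ 0ᶠ                ≡⟨ -ᶠ-inverseʳ 0ᶠ ⟩
      0ᶠ                      ∎))
      where
      x : F
      x = ρ (Fin.suc i)

  eval-zeros : ∀ n x → eval (replicate n 0ᶠ) x ≡ x ^ᶠ n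
  eval-zeros zero    x = refl
  eval-zeros (suc n) x = trans (+ᶠ-identityˡ _) (cong (x *ᶠ_) (eval-zeros n x))

  -- Otherwise the n + 2 residues 1, ..., n + 2, nonzero and distinct because n + 2 < p, would all
  -- be roots of X^(n + 1) - 1.
  not-all-roots-of-1 : ∀ n → suc n < p ∸ 1 → ∃[ x ] (x ≢ 0ᶠ × x ^ᶠ suc n ≢ 1ᶠ)
  not-all-roots-of-1 n bound = let x , not-fine = witness in x , not-fine ∘ inj₁ , not-fine ∘ inj₂
    where
    Fine : F → Set
    Fine x = x ≡ 0ᶠ ⊎ x ^ᶠ suc n ≡ 1ᶠ
    fine? : ∀ x → Dec (Fine x)
    fine? x = (x Finₚ.≟ 0ᶠ) ⊎-dec (x ^ᶠ suc n Finₚ.≟ 1ᶠ)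
    poly : Vec F (suc n)
    poly = -ᶠ 1ᶠ ∷ replicate n 0ᶠ
    n+2<p : suc (suc n) < p
    n+2<p = subst (suc (suc (suc n)) ≤_) (ℕ.m+[n∸m]≡n {1} {p} (ℕ.>-nonZero⁻¹ p)) (s≤s bound)
    index : Fin (suc (suc n)) → ℕ
    index i = suc (toℕ i)
    index<p : ∀ i → index i < p
    index<p i = ℕ.≤-<-trans (Finₚ.toℕ<n i) n+2<p
    ρ : Fin (suc (suc n)) → F
    ρ i = fromℕ< (index<p i)
    ρ-injective : ∀ {i j} → ρ i ≡ ρ j → i ≡ j
    ρ-injective {i} {j} eq = Finₚ.toℕ-injective (ℕ.suc-injective (Finₚ.fromℕ<-injective _ _ (index<p i) (index<p j) eq))
    ρ≢0 : ∀ i → ρ i ≢ 0ᶠ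
    ρ≢0 i eq = contradiction (ℕ.∣⇒≤ (ℤ.∣⇒∣ᵤ (ι-≡0⇒∣ {+ index i} (trans (cong (ι ∘ +_) (sym (Finₚ.toℕ-fromℕ< (index<p i)))) (trans (ι-lift _) eq))))) (ℕ.<⇒≱ (index<p i))
    root : (∀ x → Fine x) → ∀ i → eval poly (ρ i) ≡ 0ᶠ
    root all i with all (ρ i)
    ... | inj₁ eq = contradiction eq (ρ≢0 i)
    ... | inj₂ eq = trans (cong (λ t → -ᶠ 1ᶠ +ᶠ ρ i *ᶠ t) (eval-zeros n (ρ i))) (trans (cong (-ᶠ 1ᶠ +ᶠ_) eq) (-ᶠ-inverseˡ 1ᶠ))
    witness : ∃[ x ] ¬ Fine x
    witness = Finₚ.¬∀⟶∃¬ p Fine fine? λ all → few-roots poly ρ ρ-injective (root all)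

  -- Total inversion, signs and quadratic nonresidues.

  inv-of : ∀ x → Dec (x ≡ 0ᶠ) → F
  inv-of x (yes _)  = 0ᶠ
  inv-of x (no x≢0) = proj₁ (inverse x x≢0)

  -- Junk value: inv 0ᶠ ≡ 0ᶠ, which makes inv an involution of F.
  inv : F → F
  inv x = inv-of x (x Finₚ.≟ 0ᶠ)

  inv-of-0 : ∀ d → inv-of 0ᶠ d ≡ 0ᶠ
  inv-of-0 (yes _)  = refl
  inv-of-0 (no 0≢0) = contradiction refl 0≢0

  inv-of-inverseʳ : ∀ {x} d → x ≢ 0ᶠ → x *ᶠ inv-of x d ≡ 1ᶠ
  inv-of-inverseʳ (yes x≡0) x≢0 = contradiction x≡0 x≢0
  inv-of-inverseʳ {x} (no x≢0) _ = proj₂ (inverse x x≢0)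

  inv-0 : inv 0ᶠ ≡ 0ᶠ
  inv-0 = inv-of-0 (0ᶠ Finₚ.≟ 0ᶠ)

  inv-inverseʳ : ∀ {x} → x ≢ 0ᶠ → x *ᶠ inv x ≡ 1ᶠ
  inv-inverseʳ {x} = inv-of-inverseʳ (x Finₚ.≟ 0ᶠ)

  *ᶠ≡1⇒≢0 : ∀ {x y} → x *ᶠ y ≡ 1ᶠ → x ≢ 0ᶠ
  *ᶠ≡1⇒≢0 {y = y} xy≡1 refl = 1≢0 (trans (sym xy≡1) (*ᶠ-zeroˡ y))

  inv-unique : ∀ {x y} → x *ᶠ y ≡ 1ᶠ → inv x ≡ y
  inv-unique {x} {y} xy≡1 = *ᶠ-cancelʳ x≢0 (begin
    inv x *ᶠ x  ≡⟨ *ᶠ-comm _ _ ⟩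
    x *ᶠ inv x  ≡⟨ inv-inverseʳ x≢0 ⟩
    1ᶠ          ≡⟨ sym xy≡1 ⟩
    x *ᶠ y      ≡⟨ *ᶠ-comm _ _ ⟩
    y *ᶠ x      ∎)
    where
    x≢0 : x ≢ 0ᶠ
    x≢0 = *ᶠ≡1⇒≢0 xy≡1

  inv-involutive : ∀ x → inv (inv x) ≡ x
  inv-involutive x = by-cases (x Finₚ.≟ 0ᶠ)
    where
    by-cases : Dec (x ≡ 0ᶠ) → inv (inv x) ≡ x
    by-cases (yes x≡0) = begin
      inv (inv x)   ≡⟨ cong (inv ∘ inv) x≡0 ⟩
      inv (inv 0ᶠ)  ≡⟨ cong inv inv-0 ⟩
      inv 0ᶠ        ≡⟨ inv-0 ⟩
      0ᶠ            ≡⟨ sym x≡0 ⟩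
      x             ∎
    by-cases (no x≢0) = inv-unique (trans (*ᶠ-comm _ _) (inv-inverseʳ x≢0))

  -ᶠ-involutive : ∀ x → -ᶠ (-ᶠ x) ≡ x
  -ᶠ-involutive = solve 1 (λ x → :- (:- x) := x) refl

  square≡1 : ∀ {x} → x *ᶠ x ≡ 1ᶠ → x ≡ 1ᶠ ⊎ x ≡ -ᶠ 1ᶠ
  square≡1 {x} eq = Sum.map -ᶠ-≡0⇒≡ (λ e → -ᶠ-≡0⇒≡ (trans (cong (x +ᶠ_) (-ᶠ-involutive 1ᶠ)) e))
    (zeroProduct (x -ᶠ 1ᶠ) (x +ᶠ 1ᶠ) (begin
      (x -ᶠ 1ᶠ) *ᶠ (x +ᶠ 1ᶠ)  ≡⟨ solve 2 (λ x u → (x :- u) :* (x :+ u) := x :* x :- u :* u) refl x 1ᶠ ⟩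
      x *ᶠ x -ᶠ 1ᶠ *ᶠ 1ᶠ      ≡⟨ cong₂ _-ᶠ_ eq (*ᶠ-identityˡ 1ᶠ) ⟩
      1ᶠ -ᶠ 1ᶠ                ≡⟨ -ᶠ-inverseʳ 1ᶠ ⟩
      0ᶠ                      ∎))

  1≢-1 : 2 < p → 1ᶠ ≢ -ᶠ 1ᶠ
  1≢-1 2<p eq = contradiction (ℕ.∣⇒≤ (ℤ.∣⇒∣ᵤ (ι-≡0⇒∣ {+ 2} (begin
    ι (+ 2)            ≡⟨ ι-+ (+ 1) (+ 1) ⟩
    ι (+ 1) +ᶠ ι (+ 1) ≡⟨ cong₂ _+ᶠ_ ι-1 (trans ι-1 eq) ⟩
    1ᶠ -ᶠ 1ᶠ           ≡⟨ -ᶠ-inverseʳ 1ᶠ ⟩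
    0ᶠ                 ∎)))) (ℕ.<⇒≱ 2<p)

  -1^odd : ∀ k → (-ᶠ 1ᶠ) ^ᶠ suc (2 * k) ≡ -ᶠ 1ᶠ
  -1^odd k = begin
    -ᶠ 1ᶠ *ᶠ (-ᶠ 1ᶠ) ^ᶠ (2 * k)   ≡⟨ cong (-ᶠ 1ᶠ *ᶠ_) (sym (^ᶠ-assocʳ (-ᶠ 1ᶠ) 2 k)) ⟩
    -ᶠ 1ᶠ *ᶠ ((-ᶠ 1ᶠ) ^ᶠ 2) ^ᶠ k  ≡⟨ cong (λ t → -ᶠ 1ᶠ *ᶠ t ^ᶠ k) sq ⟩
    -ᶠ 1ᶠ *ᶠ 1ᶠ ^ᶠ k              ≡⟨ cong (-ᶠ 1ᶠ *ᶠ_) (1^ᶠ k) ⟩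
    -ᶠ 1ᶠ *ᶠ 1ᶠ                   ≡⟨ *ᶠ-identityʳ _ ⟩
    -ᶠ 1ᶠ                         ∎
    where
    sq : (-ᶠ 1ᶠ) ^ᶠ 2 ≡ 1ᶠ
    sq = trans (solve 1 (λ u → (:- u) :* ((:- u) :* u) := u :* (u :* u)) refl 1ᶠ)
      (trans (*ᶠ-identityˡ _) (*ᶠ-identityˡ _))

  neg-^-odd : ∀ k x → (-ᶠ x) ^ᶠ suc (2 * k) ≡ -ᶠ (x ^ᶠ suc (2 * k))
  neg-^-odd k x = begin
    (-ᶠ x) ^ᶠ f               ≡⟨ cong (_^ᶠ f) (neg-1 x) ⟩
    (-ᶠ 1ᶠ *ᶠ x) ^ᶠ f         ≡⟨ ^ᶠ-distrib-* (-ᶠ 1ᶠ) x f ⟩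
    (-ᶠ 1ᶠ) ^ᶠ f *ᶠ x ^ᶠ f    ≡⟨ cong (_*ᶠ x ^ᶠ f) (-1^odd k) ⟩
    -ᶠ 1ᶠ *ᶠ x ^ᶠ f           ≡⟨ sym (neg-1 _) ⟩
    -ᶠ (x ^ᶠ f)               ∎
    where
    f : ℕ
    f = suc (2 * k)
    neg-1 : ∀ x → -ᶠ x ≡ -ᶠ 1ᶠ *ᶠ x
    neg-1 x = trans (cong -ᶠ_ (sym (*ᶠ-identityˡ x))) (solve 2 (λ u x → :- (u :* x) := :- u :* x) refl 1ᶠ x)

  -1*-1 : -ᶠ 1ᶠ *ᶠ -ᶠ 1ᶠ ≡ 1ᶠ
  -1*-1 = trans (solve 1 (λ u → :- u :* :- u := u :* u) refl 1ᶠ) (*ᶠ-identityˡ 1ᶠ)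

  -1≢0 : -ᶠ 1ᶠ ≢ 0ᶠ
  -1≢0 = *ᶠ≡1⇒≢0 -1*-1

  1+≡0⇒≡-1 : ∀ {x} → 1ᶠ +ᶠ x ≡ 0ᶠ → x ≡ -ᶠ 1ᶠ
  1+≡0⇒≡-1 {x} eq = -ᶠ-≡0⇒≡ (trans (solve 2 (λ u x → x :- (:- u) := u :+ x) refl 1ᶠ x) eq)

  -- Here h + 1 = (p - 1)/2. By Fermat x^(h + 1) has square 1, hence is 1 or -1, and by the bound on
  -- roots it is not 1 for every nonzero x.
  nonresidue : ∀ h → p ≡ suc (2 * suc h) → ∃[ x ] (x ≢ 0ᶠ × x ^ᶠ suc h ≡ -ᶠ 1ᶠ)
  nonresidue h eq = let x , x≢0 , ≢1 = found in x , x≢0 ,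
      Sum.[ (λ e → contradiction e ≢1) , (λ e → e) ]′ (square≡1 (squares x x≢0))
    where
    found : ∃[ x ] (x ≢ 0ᶠ × x ^ᶠ suc h ≢ 1ᶠ)
    found = not-all-roots-of-1 h (subst (λ t → suc h < t ∸ 1) (sym eq) (ℕ.m<m+n (suc h) (s≤s z≤n)))
    squares : ∀ x → x ≢ 0ᶠ → x ^ᶠ suc h *ᶠ x ^ᶠ suc h ≡ 1ᶠ
    squares x x≢0 = begin
      x ^ᶠ suc h *ᶠ x ^ᶠ suc h  ≡⟨ sym (^ᶠ-homo-* x (suc h) (suc h)) ⟩
      x ^ᶠ (suc h + suc h)      ≡⟨ cong (x ^ᶠ_) (trans (cong (suc h ℕ.+_) (sym (ℕ.+-identityʳ (suc h)))) (cong (_∸ 1) (sym eq))) ⟩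
      x ^ᶠ (p ∸ 1)              ≡⟨ fermat x≢0 ⟩
      1ᶠ                        ∎

  -- Counting by sums of indicators.

  δ-of : ∀ {x y : F} → Dec (x ≡ y) → ℕ
  δ-of (yes _) = 1
  δ-of (no _)  = 0

  abstract
    -- Cardinalities are sums of products of Kronecker deltas, so that bijections become reindexings
    -- and double counting becomes an exchange of sums.
    δ : F → F → ℕ
    δ x y = δ-of (x Finₚ.≟ y)

    δ-≡ : ∀ {x y} → x ≡ y → δ x y ≡ 1
    δ-≡ {x} {y} eq = by-cases (x Finₚ.≟ y)
      where
      by-cases : (d : Dec (x ≡ y)) → δ-of d ≡ 1
      by-cases (yes _) = refl
      by-cases (no ne)  = contradiction eq ne

    δ-≢ : ∀ {x y} → x ≢ y → δ x y ≡ 0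
    δ-≢ {x} {y} ne = by-cases (x Finₚ.≟ y)
      where
      by-cases : (d : Dec (x ≡ y)) → δ-of d ≡ 0
      by-cases (yes eq) = contradiction eq ne
      by-cases (no _)   = refl

  δ-cong : ∀ {x y u v} → (x ≡ y → u ≡ v) → (u ≡ v → x ≡ y) → δ x y ≡ δ u v
  δ-cong {x} {y} {u} {v} to from = by-cases (x Finₚ.≟ y)
    where
    by-cases : Dec (x ≡ y) → δ x y ≡ δ u v
    by-cases (yes eq) = trans (δ-≡ eq) (sym (δ-≡ (to eq)))
    by-cases (no ne)   = trans (δ-≢ ne) (sym (δ-≢ (ne ∘ from)))

  -- The first factor is a guard: its equation may be used to rewrite the second.
  δ-*-cong : ∀ {x y m n} → (x ≡ y → m ≡ n) → δ x y * m ≡ δ x y * n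
  δ-*-cong {x} {y} {m} {n} h = by-cases (x Finₚ.≟ y)
    where
    by-cases : Dec (x ≡ y) → δ x y * m ≡ δ x y * n
    by-cases (yes eq) = cong (δ x y *_) (h eq)
    by-cases (no ne)   = trans (cong (_* m) (δ-≢ ne)) (sym (cong (_* n) (δ-≢ ne)))

  δδ-cong : ∀ {x y u v x′ y′ u′ v′} → (x ≡ y → u ≡ v → x′ ≡ y′ × u′ ≡ v′) →
            (x′ ≡ y′ → u′ ≡ v′ → x ≡ y × u ≡ v) → δ x y * δ u v ≡ δ x′ y′ * δ u′ v′
  δδ-cong {x} {y} {u} {v} {x′} {y′} {u′} {v′} to from = by-cases (x Finₚ.≟ y) (u Finₚ.≟ v)
    where
    vanish : ∀ {x y u v} → ¬ (x ≡ y × u ≡ v) → δ x y * δ u v ≡ 0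
    vanish {x} {y} {u} {v} not = trans (δ-*-cong (λ eq → δ-≢ (λ eq′ → not (eq , eq′)))) (ℕ.*-zeroʳ (δ x y))
    one : ∀ {x y u v} → x ≡ y × u ≡ v → δ x y * δ u v ≡ 1
    one (eq , eq′) = cong₂ _*_ (δ-≡ eq) (δ-≡ eq′)
    neither : ¬ (x ≡ y × u ≡ v) → δ x y * δ u v ≡ δ x′ y′ * δ u′ v′
    neither not = trans (vanish not) (sym (vanish λ (e , e′) → not (from e e′)))
    by-cases : Dec (x ≡ y) → Dec (u ≡ v) → δ x y * δ u v ≡ δ x′ y′ * δ u′ v′
    by-cases (yes e) (yes e′) = trans (one (e , e′)) (sym (one (to e e′)))
    by-cases (no ne) _        = neither (ne ∘ proj₁)
    by-cases (yes _) (no ne)  = neither (ne ∘ proj₂)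

  module ∑ where
    open Algebra.Properties.CommutativeMonoid.Sum ℕ.+-0-commutativeMonoid public
    open Algebra.Properties.Semiring.Sum ℕ.+-*-semiring public using (*-distribˡ-sum; *-distribʳ-sum)

  ∑ : (F → ℕ) → ℕ
  ∑ = ∑.sum

  ∑-cong : ∀ {t t′ : F → ℕ} → (∀ x → t x ≡ t′ x) → ∑ t ≡ ∑ t′
  ∑-cong = ∑.sum-cong-≗

  ∑-reindex : (t : F → ℕ) (π π⁻¹ : F → F) → (∀ x → π (π⁻¹ x) ≡ x) → (∀ x → π⁻¹ (π x) ≡ x) →
              ∑ t ≡ ∑ (t ∘ π)
  ∑-reindex t π π⁻¹ invˡ invʳ = ∑.sum-permute t (permutation π π⁻¹ invˡ invʳ)

  ∑-1 : ∀ n → ∑.sum {n} (λ _ → 1) ≡ n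
  ∑-1 zero    = refl
  ∑-1 (suc n) = cong suc (∑-1 n)

  ∑-δ : ∀ c → ∑ (λ x → δ x c) ≡ 1
  ∑-δ c = go c (λ x → δ x c) (δ-≡ refl) (λ x x≢c → δ-≢ x≢c)
    where
    zeros : ∀ {n} (t : Fin n → ℕ) → (∀ i → t i ≡ 0) → ∑.sum t ≡ 0
    zeros {n} t t≡0 = trans (∑.sum-cong-≗ t≡0) (∑.sum-replicate-zero n)
    go : ∀ {n} (c : Fin n) (t : Fin n → ℕ) → t c ≡ 1 → (∀ i → i ≢ c → t i ≡ 0) → ∑.sum t ≡ 1
    go {suc n} c t tc≡1 t≡0 = begin
      ∑.sum t                          ≡⟨ ∑.sum-remove {i = c} t ⟩
      t c + ∑.sum (t ∘ Fin.punchIn c)  ≡⟨ cong₂ _+_ tc≡1 (zeros (t ∘ Fin.punchIn c) (λ i → t≡0 _ (Finₚ.punchInᵢ≢i c i))) ⟩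
      1                                ∎

  -- The common form of all bijections below: a permutation of the field that carries one pair of
  -- conditions to another.
  ∑-δδ-reindex : ∀ {a b a′ b′ : F → F} {α β α′ β′} (π π⁻¹ : F → F) →
    (∀ x → π (π⁻¹ x) ≡ x) → (∀ x → π⁻¹ (π x) ≡ x) →
    (∀ x → a x ≡ α → b x ≡ β → a′ (π x) ≡ α′ × b′ (π x) ≡ β′) →
    (∀ x → a′ (π x) ≡ α′ → b′ (π x) ≡ β′ → a x ≡ α × b x ≡ β) →
    ∑ (λ x → δ (a x) α * δ (b x) β) ≡ ∑ (λ x → δ (a′ x) α′ * δ (b′ x) β′)
  ∑-δδ-reindex {a′ = a′} {b′} {α′ = α′} {β′} π π⁻¹ invˡ invʳ to from = trans
    (∑-cong (λ x → δδ-cong (to x) (from x)))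
    (sym (∑-reindex (λ x → δ (a′ x) α′ * δ (b′ x) β′) π π⁻¹ invˡ invʳ))

  sumOver : List F → (F → ℕ) → ℕ
  sumOver ζs t = ListAction.sum (List.map t ζs)

  sumOver-cong : ∀ ζs {t t′ : F → ℕ} → (∀ ζ → t ζ ≡ t′ ζ) → sumOver ζs t ≡ sumOver ζs t′
  sumOver-cong []       eq = refl
  sumOver-cong (ζ ∷ ζs) eq = cong₂ _+_ (eq ζ) (sumOver-cong ζs eq)

  *-distribˡ-sumOver : ∀ m ζs t → m * sumOver ζs t ≡ sumOver ζs (λ ζ → m * t ζ)
  *-distribˡ-sumOver m []       t = ℕ.*-zeroʳ m
  *-distribˡ-sumOver m (ζ ∷ ζs) t = trans (ℕ.*-distribˡ-+ m (t ζ) _) (cong (_ ℕ.+_) (*-distribˡ-sumOver m ζs t))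

  sumOver-∑-comm : ∀ ζs (t : F → F → ℕ) → ∑ (λ x → sumOver ζs (t x)) ≡ sumOver ζs (λ ζ → ∑ (λ x → t x ζ))
  sumOver-∑-comm []       t = ∑.sum-replicate-zero p
  sumOver-∑-comm (ζ ∷ ζs) t = trans (∑.∑-distrib-+ (λ x → t x ζ) (λ x → sumOver ζs (t x))) (cong (_ ℕ.+_) (sumOver-∑-comm ζs t))

  -- Exactly one term survives, as z occurs in the list once. Read from right to left, this splits a
  -- quantity according to the value z.
  sumOver-δ : ∀ {z ζs} (q : F → ℕ) → Unique ζs → z ∈ ζs → sumOver ζs (λ ζ → δ z ζ * q ζ) ≡ q z
  sumOver-δ {z} {_ ∷ ζs} q (z≢ ∷ _) (here refl) = begin
    δ z z * q z + sumOver ζs (λ ζ → δ z ζ * q ζ)  ≡⟨ cong₂ (λ m n → m * q z + n) (δ-≡ refl) (vanish z≢) ⟩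
    1 * q z + 0                                    ≡⟨ trans (ℕ.+-identityʳ _) (ℕ.*-identityˡ _) ⟩
    q z                                            ∎
    where
    vanish : ∀ {ζs} → All.All (z ≢_) ζs → sumOver ζs (λ ζ → δ z ζ * q ζ) ≡ 0
    vanish []           = refl
    vanish (z≢ζ ∷ rest) = cong₂ _+_ (cong (_* q _) (δ-≢ z≢ζ)) (vanish rest)
  sumOver-δ {z} {ζ ∷ ζs} q (ζ≢ ∷ unique) (there z∈) =
    cong₂ _+_ (cong (_* q ζ) (δ-≢ (λ z≡ζ → All.lookup ζ≢ z∈ (sym z≡ζ)))) (sumOver-δ q unique z∈)

-- The quartic character for p = 4f + 1 with f odd.

module Quartic (p : ℕ) (p-prime : Prime p) (k : ℕ) (p≡ : p ≡ suc (4 * suc (2 * k))) where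
  open PrimeField p p-prime
  open ≡-Reasoning

  f : ℕ
  f = suc (2 * k)

  2<p : 2 < p
  2<p = subst (2 <_) (sym p≡) (ℕ.≤-trans (s≤s (s≤s (s≤s z≤n))) (s≤s (ℕ.*-monoʳ-≤ 4 {1} {f} (s≤s z≤n))))

  -- A quartic character with values in the field itself, where the fourth roots of unity 1, -1, i,
  -- -i already live. It is extended by ψ 0 = 0.
  ψ : F → F
  ψ x = x ^ᶠ f

  ψ-* : ∀ x y → ψ (x *ᶠ y) ≡ ψ x *ᶠ ψ y
  ψ-* x y = ^ᶠ-distrib-* x y f

  ψ-0 : ψ 0ᶠ ≡ 0ᶠ
  ψ-0 = 0^ᶠ f

  ψ-1 : ψ 1ᶠ ≡ 1ᶠ
  ψ-1 = 1^ᶠ f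

  ψ-neg : ∀ x → ψ (-ᶠ x) ≡ -ᶠ ψ x
  ψ-neg = neg-^-odd k

  ψ≡0⇒≡0 : ∀ {x} → ψ x ≡ 0ᶠ → x ≡ 0ᶠ
  ψ≡0⇒≡0 {x} eq = by-cases (x Finₚ.≟ 0ᶠ)
    where
    by-cases : Dec (x ≡ 0ᶠ) → x ≡ 0ᶠ
    by-cases (yes x≡0) = x≡0
    by-cases (no x≢0)  = contradiction eq (^ᶠ-≢0 f x≢0)

  ψ≢0⇒≢0 : ∀ {x α} → ψ x ≡ α → α ≢ 0ᶠ → x ≢ 0ᶠ
  ψ≢0⇒≢0 ψx≡α α≢0 refl = α≢0 (trans (sym ψx≡α) ψ-0)

  abstract
    -- Despite its name, a quadratic nonresidue g: from g^(2f) = -1 it follows that ψ g is a square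
    -- root of -1.
    generator : ∃[ x ] (x ≢ 0ᶠ × x ^ᶠ (2 * f) ≡ -ᶠ 1ᶠ)
    generator = nonresidue (2 * k + 1 * f) (trans p≡ (cong suc (eq k)))
      where
      eq : ∀ k → 4 * suc (2 * k) ≡ 2 * suc (2 * k + 1 * suc (2 * k))
      eq = ℕ-Ring.solve-∀

  g i -i -1ᶠ : F
  g = proj₁ generator
  i = ψ g
  -i = -ᶠ i
  -1ᶠ = -ᶠ 1ᶠ

  g≢0 : g ≢ 0ᶠ
  g≢0 = proj₁ (proj₂ generator)

  i*i : i *ᶠ i ≡ -1ᶠ
  i*i = begin
    g ^ᶠ f *ᶠ g ^ᶠ f  ≡⟨ sym (^ᶠ-homo-* g f f) ⟩
    g ^ᶠ (f + f)      ≡⟨ cong (λ n → g ^ᶠ (f + n)) (sym (ℕ.+-identityʳ f)) ⟩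
    g ^ᶠ (2 * f)      ≡⟨ proj₂ (proj₂ generator) ⟩
    -1ᶠ               ∎

  neg*neg : ∀ x y → -ᶠ x *ᶠ -ᶠ y ≡ x *ᶠ y
  neg*neg = solve 2 (λ x y → :- x :* :- y := x :* y) refl

  neg*ʳ : ∀ x y → x *ᶠ -ᶠ y ≡ -ᶠ (x *ᶠ y)
  neg*ʳ = solve 2 (λ x y → x :* :- y := :- (x :* y)) refl

  1*1 : 1ᶠ *ᶠ 1ᶠ ≡ 1ᶠ
  1*1 = *ᶠ-identityˡ 1ᶠ

  -i*-i : -i *ᶠ -i ≡ -1ᶠ
  -i*-i = trans (neg*neg i i) i*i

  i*-i : i *ᶠ -i ≡ 1ᶠ
  i*-i = trans (neg*ʳ i i) (trans (cong -ᶠ_ i*i) (-ᶠ-involutive 1ᶠ))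

  -i*i : -i *ᶠ i ≡ 1ᶠ
  -i*i = trans (*ᶠ-comm -i i) i*-i

  i≢0 : i ≢ 0ᶠ
  i≢0 = *ᶠ≡1⇒≢0 i*-i

  -i≢0 : -i ≢ 0ᶠ
  -i≢0 = *ᶠ≡1⇒≢0 -i*i

  squares-differ : ∀ {x y} → x *ᶠ x ≡ 1ᶠ → y *ᶠ y ≡ -1ᶠ → x ≢ y
  squares-differ x² y² refl = 1≢-1 2<p (trans (sym x²) y²)

  i≢-i : i ≢ -i
  i≢-i eq = 1≢-1 2<p (trans (sym i*-i) (trans (cong (i *ᶠ_) (sym eq)) i*i))

  -- The order 0, 1, -1, i, -i is that of the summands in every row and energy relation below; the
  -- final `+ 0` there is the empty list sum.
  classes : List F
  classes = 0ᶠ ∷ 1ᶠ ∷ -1ᶠ ∷ i ∷ -i ∷ []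

  classes-unique : Unique classes
  classes-unique =
      ((1≢0 ∘ sym) ∷ (-1≢0 ∘ sym) ∷ (i≢0 ∘ sym) ∷ (-i≢0 ∘ sym) ∷ [])
    ∷ (1≢-1 2<p ∷ squares-differ 1*1 i*i ∷ squares-differ 1*1 -i*-i ∷ [])
    ∷ (squares-differ -1*-1 i*i ∷ squares-differ -1*-1 -i*-i ∷ [])
    ∷ (i≢-i ∷ [])
    ∷ []
    ∷ []

  -- For x ≠ 0 Fermat gives z⁴ = 1 with z = ψ x, and z⁴ - 1 splits into (z - 1)(z + 1)(z - i)(z +
  -- i).
  ψ∈classes : ∀ x → ψ x ∈ classes
  ψ∈classes x = by-cases (x Finₚ.≟ 0ᶠ)
    where
    z : F
    z = ψ x
    z²*z² : x ≢ 0ᶠ → (z *ᶠ z) *ᶠ (z *ᶠ z) ≡ 1ᶠ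
    z²*z² x≢0 = begin
      (z *ᶠ z) *ᶠ (z *ᶠ z)              ≡⟨ sym (cong₂ _*ᶠ_ (^ᶠ-homo-* x f f) (^ᶠ-homo-* x f f)) ⟩
      x ^ᶠ (f + f) *ᶠ x ^ᶠ (f + f)      ≡⟨ sym (^ᶠ-homo-* x (f + f) (f + f)) ⟩
      x ^ᶠ (f + f + (f + f))            ≡⟨ cong (x ^ᶠ_) (trans (4* f) (cong (_∸ 1) (sym p≡))) ⟩
      x ^ᶠ (p ∸ 1)                      ≡⟨ fermat x≢0 ⟩
      1ᶠ                                ∎
      where
      4* : ∀ n → n + n + (n + n) ≡ 4 * n
      4* = ℕ-Ring.solve-∀
    real : z *ᶠ z ≡ 1ᶠ → z ∈ classes
    real z² = Sum.[ (λ eq → there (here eq)) , (λ eq → there (there (here eq))) ]′ (square≡1 z²)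
    imaginary : z *ᶠ z ≡ -1ᶠ → z ∈ classes
    imaginary z² = Sum.[ (λ eq → there (there (there (here (-ᶠ-≡0⇒≡ eq))))) ,
                         (λ eq → there (there (there (there (here (-ᶠ-≡0⇒≡ (trans (cong (z +ᶠ_) (-ᶠ-involutive i)) eq))))))) ]′
      (zeroProduct (z -ᶠ i) (z +ᶠ i) (begin
        (z -ᶠ i) *ᶠ (z +ᶠ i)  ≡⟨ solve 2 (λ z i → (z :- i) :* (z :+ i) := z :* z :- i :* i) refl z i ⟩
        z *ᶠ z -ᶠ i *ᶠ i      ≡⟨ cong₂ _-ᶠ_ z² i*i ⟩
        -1ᶠ -ᶠ -1ᶠ            ≡⟨ -ᶠ-inverseʳ -1ᶠ ⟩
        0ᶠ                    ∎))
    by-cases : Dec (x ≡ 0ᶠ) → z ∈ classes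
    by-cases (yes x≡0) = here (trans (cong ψ x≡0) ψ-0)
    by-cases (no x≢0)  = Sum.[ real , imaginary ]′ (square≡1 (z²*z² x≢0))

  size : F → ℕ
  size α = ∑ (λ x → δ (ψ x) α)

  size-scale : ∀ {u α} → u ≢ 0ᶠ → size α ≡ size (ψ u *ᶠ α)
  size-scale {u} {α} u≢0 = trans
    (∑-cong (λ x → δ-cong (λ eq → trans (ψ-* u x) (cong (ψ u *ᶠ_) eq)) (λ eq → cancelˡ (trans (sym (ψ-* u x)) eq))))
    (sym (∑-reindex (λ x → δ (ψ x) (ψ u *ᶠ α)) (u *ᶠ_) (inv u *ᶠ_) (*ᶠ-inverse-cancel (inv-inverseʳ u≢0)) (*ᶠ-inverse-cancel (trans (*ᶠ-comm _ _) (inv-inverseʳ u≢0)))))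
    where
    cancelˡ : ∀ {a} → ψ u *ᶠ a ≡ ψ u *ᶠ α → a ≡ α
    cancelˡ {a} eq = *ᶠ-cancelʳ (^ᶠ-≢0 f u≢0) (trans (*ᶠ-comm a _) (trans eq (*ᶠ-comm _ α)))

  size-≡ : ∀ {u α} → u ≢ 0ᶠ → ψ u ≡ α → size α ≡ size 1ᶠ
  size-≡ {u} {α} u≢0 eq = sym (trans (size-scale u≢0) (cong size (trans (*ᶠ-identityʳ _) eq)))

  neg-≢0 : ∀ {x} → x ≢ 0ᶠ → -ᶠ x ≢ 0ᶠ
  neg-≢0 {x} x≢0 eq = x≢0 (begin
    x            ≡⟨ sym (-ᶠ-involutive x) ⟩
    -ᶠ (-ᶠ x)    ≡⟨ cong -ᶠ_ eq ⟩
    -ᶠ 0ᶠ        ≡⟨ sym (+ᶠ-identityˡ _) ⟩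
    0ᶠ -ᶠ 0ᶠ     ≡⟨ -ᶠ-inverseʳ 0ᶠ ⟩
    0ᶠ           ∎)

  -- Multiplication by -1, g and -g carries the class of 1 to the other three nonzero classes, so 1
  -- + 4n = p for their common size n.
  size-1 : size 1ᶠ ≡ f
  size-1 = ℕ.*-cancelˡ-≡ _ _ 4 (ℕ.suc-injective (begin
    suc (4 * n)                                    ≡⟨⟩
    1 + (n + (n + (n + (n + 0))))                  ≡⟨ sym (cong₂ _+_ size-0 (cong (n ℕ.+_) (cong₂ _+_ size-neg1 (cong₂ _+_ size-i (cong (ℕ._+ 0) size-neg-i))))) ⟩
    sumOver classes size                           ≡⟨ sym (sumOver-∑-comm classes (λ x ζ → δ (ψ x) ζ)) ⟩
    ∑ (λ x → sumOver classes (δ (ψ x)))            ≡⟨ ∑-cong one ⟩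
    ∑ (λ _ → 1)                                    ≡⟨ ∑-1 p ⟩
    p                                              ≡⟨ p≡ ⟩
    suc (4 * f)                                    ∎))
    where
    n : ℕ
    n = size 1ᶠ
    size-0 : size 0ᶠ ≡ 1
    size-0 = trans (∑-cong (λ x → δ-cong ψ≡0⇒≡0 (λ eq → trans (cong ψ eq) ψ-0))) (∑-δ 0ᶠ)
    size-neg1 : size -1ᶠ ≡ n
    size-neg1 = size-≡ -1≢0 (trans (ψ-neg 1ᶠ) (cong -ᶠ_ ψ-1))
    size-i : size i ≡ n
    size-i = size-≡ g≢0 refl
    size-neg-i : size -i ≡ n
    size-neg-i = size-≡ (neg-≢0 g≢0) (ψ-neg g)
    one : ∀ x → sumOver classes (δ (ψ x)) ≡ 1
    one x = trans (sumOver-cong classes (λ ζ → sym (ℕ.*-identityʳ (δ (ψ x) ζ)))) (sumOver-δ (λ _ → 1) classes-unique (ψ∈classes x))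

  size-neg1 : size -1ᶠ ≡ f
  size-neg1 = trans (size-≡ -1≢0 (trans (ψ-neg 1ᶠ) (cong -ᶠ_ ψ-1))) size-1

  size-i : size i ≡ f
  size-i = trans (size-≡ g≢0 refl) size-1

  -- Symmetries of these counts and the linear relations.

  -- These are the cyclotomic numbers of order four.
  P : F → F → ℕ
  P α β = ∑ (λ y → δ (ψ y) α * δ (ψ (1ᶠ +ᶠ y)) β)

  P-involution : ∀ {α β α′ β′} (π : F → F) → (∀ y → π (π y) ≡ y) →
    (∀ y → ψ y ≡ α → ψ (1ᶠ +ᶠ y) ≡ β → ψ (π y) ≡ α′ × ψ (1ᶠ +ᶠ π y) ≡ β′) →
    (∀ y → ψ y ≡ α′ → ψ (1ᶠ +ᶠ y) ≡ β′ → ψ (π y) ≡ α × ψ (1ᶠ +ᶠ π y) ≡ β) →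
    P α β ≡ P α′ β′
  P-involution π inv to from = ∑-δδ-reindex π π inv inv to
    λ y eq eq′ → subst (λ y → ψ y ≡ _ × ψ (1ᶠ +ᶠ y) ≡ _) (inv y) (from (π y) eq eq′)

  -- The reflection y ↦ -(1 + y) exchanges y and 1 + y up to sign, and ψ is odd.
  P-swap : ∀ α β → P α β ≡ P (-ᶠ β) (-ᶠ α)
  P-swap α β = P-involution (λ y → -ᶠ (1ᶠ +ᶠ y)) reflect-involutive step
    λ y eq eq′ → let e , e′ = step y eq eq′ in trans e (-ᶠ-involutive α) , trans e′ (-ᶠ-involutive β)
    where
    reflect-involutive : ∀ y → -ᶠ (1ᶠ +ᶠ -ᶠ (1ᶠ +ᶠ y)) ≡ y
    reflect-involutive = solve 2 (λ u y → :- (u :+ :- (u :+ y)) := y) refl 1ᶠ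
    step : ∀ {α β} y → ψ y ≡ α → ψ (1ᶠ +ᶠ y) ≡ β → ψ (-ᶠ (1ᶠ +ᶠ y)) ≡ -ᶠ β × ψ (1ᶠ +ᶠ -ᶠ (1ᶠ +ᶠ y)) ≡ -ᶠ α
    step y eq eq′ = trans (ψ-neg _) (cong -ᶠ_ eq′) ,
      trans (cong ψ (solve 2 (λ u y → u :+ :- (u :+ y) := :- y) refl 1ᶠ y)) (trans (ψ-neg y) (cong -ᶠ_ eq))

  -- The substitution y ↦ 1/y, with 1 + 1/y = (1 + y)/y.
  P-invert : ∀ {α α′} β → α *ᶠ α′ ≡ 1ᶠ → P α β ≡ P α′ (β *ᶠ α′)
  P-invert {α} {α′} β αα′≡1 = P-involution inv inv-involutive (step αα′≡1)
    λ y eq eq′ → let e , e′ = step (trans (*ᶠ-comm α′ α) αα′≡1) y eq eq′ in e , trans e′ (begin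
      β *ᶠ α′ *ᶠ α    ≡⟨ *ᶠ-assoc β α′ α ⟩
      β *ᶠ (α′ *ᶠ α)  ≡⟨ cong (β *ᶠ_) (trans (*ᶠ-comm α′ α) αα′≡1) ⟩
      β *ᶠ 1ᶠ         ≡⟨ *ᶠ-identityʳ β ⟩
      β               ∎)
    where
    step : ∀ {α α′ β} → α *ᶠ α′ ≡ 1ᶠ → ∀ y → ψ y ≡ α → ψ (1ᶠ +ᶠ y) ≡ β →
           ψ (inv y) ≡ α′ × ψ (1ᶠ +ᶠ inv y) ≡ β *ᶠ α′
    step {α} {α′} {β} αα′≡1 y eq eq′ = ψ-inv , (begin
      ψ (1ᶠ +ᶠ inv y)               ≡⟨ cong (λ t → ψ (t +ᶠ inv y)) (sym y*inv) ⟩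
      ψ (y *ᶠ inv y +ᶠ inv y)       ≡⟨ cong ψ (solve 2 (λ y v → y :* v :+ v := (con (+ 1) :+ y) :* v) refl y (inv y)) ⟩
      ψ ((ι (+ 1) +ᶠ y) *ᶠ inv y)   ≡⟨ cong (λ t → ψ ((t +ᶠ y) *ᶠ inv y)) ι-1 ⟩
      ψ ((1ᶠ +ᶠ y) *ᶠ inv y)        ≡⟨ ψ-* _ _ ⟩
      ψ (1ᶠ +ᶠ y) *ᶠ ψ (inv y)      ≡⟨ cong₂ _*ᶠ_ eq′ ψ-inv ⟩
      β *ᶠ α′                       ∎)
      where
      y*inv : y *ᶠ inv y ≡ 1ᶠ
      y*inv = inv-inverseʳ (ψ≢0⇒≢0 eq (*ᶠ≡1⇒≢0 αα′≡1))
      ψ-inv : ψ (inv y) ≡ α′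
      ψ-inv = begin
        ψ (inv y)  ≡⟨ sym (inv-unique (trans (cong (_*ᶠ ψ (inv y)) (sym eq)) (trans (sym (ψ-* y (inv y))) (trans (cong ψ y*inv) ψ-1)))) ⟩
        inv α      ≡⟨ inv-unique αα′≡1 ⟩
        α′         ∎

  -- Grouping y by the class of 1 + y. With a cyclotomic number as `q`, this turns a double count
  -- into a quadratic expression in those numbers.
  ∑-by-class : ∀ α (Q q : F → ℕ) → (∀ y → ψ y ≡ α → Q (1ᶠ +ᶠ y) ≡ q (ψ (1ᶠ +ᶠ y))) →
               ∑ (λ y → δ (ψ y) α * Q (1ᶠ +ᶠ y)) ≡ sumOver classes (λ ζ → P α ζ * q ζ)
  ∑-by-class α Q q Q≡q = begin
    ∑ (λ y → δ (ψ y) α * Q (1ᶠ +ᶠ y))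
      ≡⟨ ∑-cong (λ y → trans (δ-*-cong (λ eq → trans (Q≡q y eq) (sym (sumOver-δ q classes-unique (ψ∈classes _)))))
                             (trans (*-distribˡ-sumOver (δ (ψ y) α) classes (λ ζ → δ (ψ (1ᶠ +ᶠ y)) ζ * q ζ)) (sumOver-cong classes (λ ζ → sym (ℕ.*-assoc (δ (ψ y) α) (δ (ψ (1ᶠ +ᶠ y)) ζ) (q ζ)))))) ⟩
    ∑ (λ y → sumOver classes (λ ζ → δ (ψ y) α * δ (ψ (1ᶠ +ᶠ y)) ζ * q ζ))
      ≡⟨ sumOver-∑-comm classes (λ y ζ → δ (ψ y) α * δ (ψ (1ᶠ +ᶠ y)) ζ * q ζ) ⟩
    sumOver classes (λ ζ → ∑ (λ y → δ (ψ y) α * δ (ψ (1ᶠ +ᶠ y)) ζ * q ζ))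
      ≡⟨ sumOver-cong classes (λ ζ → sym (∑.*-distribʳ-sum (q ζ) (λ y → δ (ψ y) α * δ (ψ (1ᶠ +ᶠ y)) ζ))) ⟩
    sumOver classes (λ ζ → P α ζ * q ζ) ∎

  P-row : ∀ α → size α ≡ sumOver classes (P α)
  P-row α = begin
    ∑ (λ y → δ (ψ y) α)                 ≡⟨ ∑-cong (λ y → sym (ℕ.*-identityʳ _)) ⟩
    ∑ (λ y → δ (ψ y) α * 1)             ≡⟨ ∑-by-class α (λ _ → 1) (λ _ → 1) (λ _ _ → refl) ⟩
    sumOver classes (λ ζ → P α ζ * 1)   ≡⟨ sumOver-cong classes (λ ζ → ℕ.*-identityʳ (P α ζ)) ⟩
    sumOver classes (P α)               ∎

  -- Only y = -1 makes 1 + y vanish, and its class is -1 because f is odd. This is the extra 1 in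
  -- the row of -1.
  P-0 : ∀ α → P α 0ᶠ ≡ δ -1ᶠ α
  P-0 α = begin
    ∑ (λ y → δ (ψ y) α * δ (ψ (1ᶠ +ᶠ y)) 0ᶠ)  ≡⟨ ∑-cong (λ y → δδ-cong (to y) (from y)) ⟩
    ∑ (λ y → δ y -1ᶠ * δ -1ᶠ α)               ≡⟨ sym (∑.*-distribʳ-sum (δ -1ᶠ α) (λ y → δ y -1ᶠ)) ⟩
    ∑ (λ y → δ y -1ᶠ) * δ -1ᶠ α               ≡⟨ cong (_* δ -1ᶠ α) (∑-δ -1ᶠ) ⟩
    1 * δ -1ᶠ α                               ≡⟨ ℕ.*-identityˡ _ ⟩
    δ -1ᶠ α                                   ∎
    where
    ψ-neg1 : ψ -1ᶠ ≡ -1ᶠ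
    ψ-neg1 = -1^odd k
    to : ∀ y → ψ y ≡ α → ψ (1ᶠ +ᶠ y) ≡ 0ᶠ → y ≡ -1ᶠ × -1ᶠ ≡ α
    to y eq eq′ = y≡-1 , trans (sym ψ-neg1) (trans (cong ψ (sym y≡-1)) eq)
      where
      y≡-1 : y ≡ -1ᶠ
      y≡-1 = 1+≡0⇒≡-1 (ψ≡0⇒≡0 eq′)
    from : ∀ y → y ≡ -1ᶠ → -1ᶠ ≡ α → ψ y ≡ α × ψ (1ᶠ +ᶠ y) ≡ 0ᶠ
    from y refl eq = trans ψ-neg1 eq , trans (cong ψ (-ᶠ-inverseʳ 1ᶠ)) ψ-0

  -- The sixteen numbers `P α β` with nonzero arguments fall into five orbits under `P-swap` and
  -- `P-invert`, of sizes 3, 3, 1, 3 and 6; these are representatives.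
  A B C D E : ℕ
  A = P 1ᶠ 1ᶠ
  B = P 1ᶠ i
  C = P 1ᶠ -1ᶠ
  D = P 1ᶠ -i
  E = P -1ᶠ i

  P≡ : ∀ {α β α′ β′} → α ≡ α′ → β ≡ β′ → P α β ≡ P α′ β′
  P≡ = cong₂ P

  -1*-i : -1ᶠ *ᶠ -i ≡ i
  -1*-i = trans (neg*neg 1ᶠ i) (*ᶠ-identityˡ i)

  P[-1,-1] : P -1ᶠ -1ᶠ ≡ A
  P[-1,-1] = sym (P-swap 1ᶠ 1ᶠ)

  P[-1,1] : P -1ᶠ 1ᶠ ≡ A
  P[-1,1] = trans (P-invert 1ᶠ -1*-1) (trans (P≡ refl (*ᶠ-identityˡ -1ᶠ)) P[-1,-1])

  P[-1,-i] : P -1ᶠ -i ≡ E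
  P[-1,-i] = trans (P-invert -i -1*-1) (P≡ refl (trans (*ᶠ-comm -i -1ᶠ) -1*-i))

  P[i,1] : P i 1ᶠ ≡ E
  P[i,1] = trans (P-swap i 1ᶠ) P[-1,-i]

  P[-i,1] : P -i 1ᶠ ≡ E
  P[-i,1] = trans (P-swap -i 1ᶠ) (P≡ refl (-ᶠ-involutive i))

  P[i,i] : P i i ≡ E
  P[i,i] = trans (P-invert i i*-i) (trans (P≡ refl i*-i) P[-i,1])

  P[-i,-i] : P -i -i ≡ E
  P[-i,-i] = trans (P-invert -i -i*i) (trans (P≡ refl -i*i) P[i,1])

  P[i,-1] : P i -1ᶠ ≡ D
  P[i,-1] = trans (P-swap i -1ᶠ) (P≡ (-ᶠ-involutive 1ᶠ) refl)

  P[-i,-1] : P -i -1ᶠ ≡ B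
  P[-i,-1] = trans (P-swap -i -1ᶠ) (P≡ (-ᶠ-involutive 1ᶠ) (-ᶠ-involutive i))

  P[i,-i] : P i -i ≡ B
  P[i,-i] = trans (P-invert -i i*-i) (trans (P≡ refl -i*-i) P[-i,-1])

  P[-i,i] : P -i i ≡ D
  P[-i,i] = trans (P-invert i -i*i) (trans (P≡ refl i*i) P[i,-1])

  row-1 : f ≡ A + (C + (B + (D + 0)))
  row-1 = begin
    f                            ≡⟨ sym size-1 ⟩
    size 1ᶠ                      ≡⟨ P-row 1ᶠ ⟩
    sumOver classes (P 1ᶠ)       ≡⟨ cong (_+ (A + (C + (B + (D + 0))))) (trans (P-0 1ᶠ) (δ-≢ (1≢-1 2<p ∘ sym))) ⟩
    A + (C + (B + (D + 0)))      ∎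

  row-neg1 : f ≡ 1 + (A + (A + (E + (E + 0))))
  row-neg1 = begin
    f                            ≡⟨ sym size-neg1 ⟩
    size -1ᶠ                     ≡⟨ P-row -1ᶠ ⟩
    sumOver classes (P -1ᶠ)      ≡⟨ cong₂ _+_ (trans (P-0 -1ᶠ) (δ-≡ refl)) (cong₂ _+_ P[-1,1] (cong₂ _+_ P[-1,-1] (cong (E ℕ.+_) (cong (ℕ._+ 0) P[-1,-i])))) ⟩
    1 + (A + (A + (E + (E + 0)))) ∎

  row-i : f ≡ E + (D + (E + (B + 0)))
  row-i = begin
    f                            ≡⟨ sym size-i ⟩
    size i                       ≡⟨ P-row i ⟩
    sumOver classes (P i)        ≡⟨ cong₂ _+_ (trans (P-0 i) (δ-≢ (squares-differ -1*-1 i*i))) (cong₂ _+_ P[i,1] (cong₂ _+_ P[i,-1] (cong₂ _+_ P[i,i] (cong (ℕ._+ 0) P[i,-i])))) ⟩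
    E + (D + (E + (B + 0)))      ∎

  -- The additive energy of the fourth powers.

  representations differences : F → ℕ
  representations w = ∑ (λ c → δ (ψ c) 1ᶠ * δ (ψ (w -ᶠ c)) 1ᶠ)
  differences w = ∑ (λ b → δ (ψ b) 1ᶠ * δ (ψ (b +ᶠ w)) 1ᶠ)

  inv≡ : ∀ {x y} → x *ᶠ y ≡ 1ᶠ → y ≡ inv x
  inv≡ = sym ∘ inv-unique

  ψ-1+ : ∀ w y → ψ (w +ᶠ w *ᶠ y) ≡ ψ w *ᶠ ψ (1ᶠ +ᶠ y)
  ψ-1+ w y = trans (cong ψ (trans (cong (_+ᶠ w *ᶠ y) (sym (*ᶠ-identityʳ w))) (sym (*ᶠ-distribˡ w 1ᶠ y)))) (ψ-* w (1ᶠ +ᶠ y))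

  ψ*inv : ∀ {w x} → w ≢ 0ᶠ → x ≡ inv (ψ w) → ψ w *ᶠ x ≡ 1ᶠ
  ψ*inv w≢0 refl = inv-inverseʳ (^ᶠ-≢0 f w≢0)

  -- With b = w y the two arguments b and b + w become w y and w (1 + y), so both classes are
  -- divided by ψ w.
  differences-≢0 : ∀ w → w ≢ 0ᶠ → differences w ≡ P (inv (ψ w)) (inv (ψ w))
  differences-≢0 w w≢0 = sym (∑-δδ-reindex (w *ᶠ_) (inv w *ᶠ_)
    (*ᶠ-inverse-cancel (inv-inverseʳ w≢0)) (*ᶠ-inverse-cancel (trans (*ᶠ-comm _ _) (inv-inverseʳ w≢0)))
    (λ y e e′ → trans (ψ-* w y) (ψ*inv w≢0 e) , trans (shift y) (ψ*inv w≢0 e′))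
    (λ y e e′ → inv≡ (trans (sym (ψ-* w y)) e) , inv≡ (trans (sym (shift y)) e′)))
    where
    shift : ∀ y → ψ (w *ᶠ y +ᶠ w) ≡ ψ w *ᶠ ψ (1ᶠ +ᶠ y)
    shift y = trans (cong ψ (+ᶠ-comm (w *ᶠ y) w)) (ψ-1+ w y)

  -- With c = -(w y) the complement w - c becomes w (1 + y); the sign of c moves to the first class.
  representations-≢0 : ∀ w → w ≢ 0ᶠ → representations w ≡ P (-ᶠ inv (ψ w)) (inv (ψ w))
  representations-≢0 w w≢0 = sym (∑-δδ-reindex (λ y → -ᶠ (w *ᶠ y)) (λ c → -ᶠ (inv w *ᶠ c))
    (λ c → trans (neg-neg w (inv w) c) (*ᶠ-inverse-cancel (inv-inverseʳ w≢0) c))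
    (λ y → trans (neg-neg (inv w) w y) (*ᶠ-inverse-cancel (trans (*ᶠ-comm _ _) (inv-inverseʳ w≢0)) y))
    (λ y e e′ → trans (scale y) (ψ*inv w≢0 (trans (cong -ᶠ_ e) (-ᶠ-involutive _))) , trans (shift y) (ψ*inv w≢0 e′))
    (λ y e e′ → trans (sym (-ᶠ-involutive (ψ y))) (cong -ᶠ_ (inv≡ (trans (sym (scale y)) e))) , inv≡ (trans (sym (shift y)) e′)))
    where
    neg-neg : ∀ a b x → -ᶠ (a *ᶠ -ᶠ (b *ᶠ x)) ≡ a *ᶠ (b *ᶠ x)
    neg-neg = solve 3 (λ a b x → :- (a :* :- (b :* x)) := a :* (b :* x)) refl
    scale : ∀ y → ψ (-ᶠ (w *ᶠ y)) ≡ ψ w *ᶠ -ᶠ ψ y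
    scale y = trans (ψ-neg _) (trans (cong -ᶠ_ (ψ-* w y)) (sym (neg*ʳ (ψ w) (ψ y))))
    shift : ∀ y → ψ (w -ᶠ -ᶠ (w *ᶠ y)) ≡ ψ w *ᶠ ψ (1ᶠ +ᶠ y)
    shift y = trans (cong (λ t → ψ (w +ᶠ t)) (-ᶠ-involutive (w *ᶠ y))) (ψ-1+ w y)

  inv-1 : inv 1ᶠ ≡ 1ᶠ
  inv-1 = inv-unique 1*1

  inv-neg1 : inv -1ᶠ ≡ -1ᶠ
  inv-neg1 = inv-unique -1*-1

  inv-i : inv i ≡ -i
  inv-i = inv-unique i*-i

  inv-neg-i : inv -i ≡ i
  inv-neg-i = inv-unique -i*i

  energy-by-sums : ∑ (λ b → δ (ψ b) 1ᶠ * representations (1ᶠ +ᶠ b)) ≡ A * A + (C * C + (B * B + (D * D + 0)))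
  energy-by-sums = begin
    ∑ (λ b → δ (ψ b) 1ᶠ * representations (1ᶠ +ᶠ b))
      ≡⟨ ∑-by-class 1ᶠ representations q (λ b eq → representations-≢0 (1ᶠ +ᶠ b) (nonzero b eq)) ⟩
    sumOver classes (λ ζ → P 1ᶠ ζ * q ζ)
      ≡⟨ cong₂ _+_ (cong (_* q 0ᶠ) (trans (P-0 1ᶠ) (δ-≢ (1≢-1 2<p ∘ sym))))
         (cong₂ _+_ (cong (A *_) (trans (P≡ (cong -ᶠ_ inv-1) inv-1) P[-1,1]))
         (cong₂ _+_ (cong (C *_) (P≡ (trans (cong -ᶠ_ inv-neg1) (-ᶠ-involutive 1ᶠ)) inv-neg1))
         (cong₂ _+_ (cong (B *_) (trans (P≡ (trans (cong -ᶠ_ inv-i) (-ᶠ-involutive i)) inv-i) P[i,-i]))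
         (cong (ℕ._+ 0) (cong (D *_) (trans (P≡ (cong -ᶠ_ inv-neg-i) inv-neg-i) P[-i,i])))))) ⟩
    A * A + (C * C + (B * B + (D * D + 0))) ∎
    where
    q : F → ℕ
    q ζ = P (-ᶠ inv ζ) (inv ζ)
    -- -1 is not a fourth power, so 1 + b stays away from 0 and the formula for nonzero sums always
    -- applies.
    nonzero : ∀ b → ψ b ≡ 1ᶠ → 1ᶠ +ᶠ b ≢ 0ᶠ
    nonzero b ψb≡1 eq = 1≢-1 2<p (begin
      1ᶠ       ≡⟨ sym ψb≡1 ⟩
      ψ b      ≡⟨ cong ψ (1+≡0⇒≡-1 eq) ⟩
      ψ -1ᶠ    ≡⟨ -1^odd k ⟩
      -1ᶠ      ∎)

  energy-by-differences : ∑ (λ y → δ (ψ y) -1ᶠ * differences (1ᶠ +ᶠ y)) ≡ f + (A * A + (A * A + (E * E + (E * E + 0))))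
  energy-by-differences = begin
    ∑ (λ y → δ (ψ y) -1ᶠ * differences (1ᶠ +ᶠ y))
      ≡⟨ ∑-by-class -1ᶠ differences q (λ b _ → differences-class (1ᶠ +ᶠ b)) ⟩
    sumOver classes (λ ζ → P -1ᶠ ζ * q ζ)
      ≡⟨ cong₂ _+_ (trans (cong₂ _*_ (trans (P-0 -1ᶠ) (δ-≡ refl)) q-0) (ℕ.*-identityˡ f))
         (cong₂ _+_ (cong₂ _*_ P[-1,1] (trans (q-≢0 1≢0) (P≡ inv-1 inv-1)))
         (cong₂ _+_ (cong₂ _*_ P[-1,-1] (trans (q-≢0 -1≢0) (trans (P≡ inv-neg1 inv-neg1) P[-1,-1])))
         (cong₂ _+_ (cong (E *_) (trans (q-≢0 i≢0) (trans (P≡ inv-i inv-i) P[-i,-i])))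
         (cong (ℕ._+ 0) (cong₂ _*_ P[-1,-i] (trans (q-≢0 -i≢0) (trans (P≡ inv-neg-i inv-neg-i) P[i,i]))))))) ⟩
    f + (A * A + (A * A + (E * E + (E * E + 0)))) ∎
    where
    -- Here 1 + y does vanish, at y = -1: this is the diagonal b = d, with f solutions. The general
    -- formula would give `P 0ᶠ 0ᶠ`, which is 0, so the class of 0 gets its own value.
    q-of : ∀ ζ → Dec (ζ ≡ 0ᶠ) → ℕ
    q-of ζ (yes _) = f
    q-of ζ (no _)  = P (inv ζ) (inv ζ)
    q : F → ℕ
    q ζ = q-of ζ (ζ Finₚ.≟ 0ᶠ)
    q-0 : q 0ᶠ ≡ f
    q-0 = by-cases (0ᶠ Finₚ.≟ 0ᶠ)
      where
      by-cases : ∀ d → q-of 0ᶠ d ≡ f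
      by-cases (yes _)  = refl
      by-cases (no 0≢0) = contradiction refl 0≢0
    q-≢0 : ∀ {ζ} → ζ ≢ 0ᶠ → q ζ ≡ P (inv ζ) (inv ζ)
    q-≢0 {ζ} ζ≢0 = by-cases (ζ Finₚ.≟ 0ᶠ)
      where
      by-cases : ∀ d → q-of ζ d ≡ P (inv ζ) (inv ζ)
      by-cases (yes ζ≡0) = contradiction ζ≡0 ζ≢0
      by-cases (no _)    = refl
    differences-0 : differences 0ᶠ ≡ f
    differences-0 = trans (∑-cong square) size-1
      where
      square : ∀ b → δ (ψ b) 1ᶠ * δ (ψ (b +ᶠ 0ᶠ)) 1ᶠ ≡ δ (ψ b) 1ᶠ
      square b = trans (δ-*-cong (λ eq → δ-≡ (trans (cong ψ (+ᶠ-identityʳ b)) eq))) (ℕ.*-identityʳ _)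
    differences-class : ∀ w → differences w ≡ q (ψ w)
    differences-class w = by-cases (w Finₚ.≟ 0ᶠ)
      where
      by-cases : Dec (w ≡ 0ᶠ) → differences w ≡ q (ψ w)
      by-cases (yes refl) = trans differences-0 (sym (trans (cong q ψ-0) q-0))
      by-cases (no w≢0)   = trans (differences-≢0 w w≢0) (sym (q-≢0 (^ᶠ-≢0 f w≢0)))

  -- Both sides count the solutions of 1 + b = c + d in fourth powers: by the value of 1 + b, and by that of 1 - c = d - b.
  energy : A * A + (C * C + (B * B + (D * D + 0))) ≡ f + (A * A + (A * A + (E * E + (E * E + 0))))
  energy = begin
    A * A + (C * C + (B * B + (D * D + 0)))                      ≡⟨ sym energy-by-sums ⟩
    ∑ (λ b → h b * ∑ (λ c → h c * h (1ᶠ +ᶠ b -ᶠ c)))             ≡⟨ ∑-cong (λ b → ∑.*-distribˡ-sum (h b) (λ c → h c * h (1ᶠ +ᶠ b -ᶠ c))) ⟩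
    ∑ (λ b → ∑ (λ c → h b * (h c * h (1ᶠ +ᶠ b -ᶠ c))))           ≡⟨ ∑.∑-comm (λ b c → h b * (h c * h (1ᶠ +ᶠ b -ᶠ c))) ⟩
    ∑ (λ c → ∑ (λ b → h b * (h c * h (1ᶠ +ᶠ b -ᶠ c))))           ≡⟨ ∑-cong (λ c → ∑-cong (λ b → regroup b c)) ⟩
    ∑ (λ c → ∑ (λ b → h c * (h b * h (b +ᶠ (1ᶠ +ᶠ -ᶠ c)))))      ≡⟨ ∑-cong (λ c → sym (∑.*-distribˡ-sum (h c) (λ b → h b * h (b +ᶠ (1ᶠ +ᶠ -ᶠ c))))) ⟩
    -- Replacing c by -y turns 1 - c into 1 + y and the class of 1 into that of -1.
    ∑ (λ c → h c * differences (1ᶠ +ᶠ -ᶠ c))                     ≡⟨ ∑-reindex (λ c → h c * differences (1ᶠ +ᶠ -ᶠ c)) -ᶠ_ -ᶠ_ -ᶠ-involutive -ᶠ-involutive ⟩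
    ∑ (λ y → h (-ᶠ y) * differences (1ᶠ +ᶠ -ᶠ (-ᶠ y)))           ≡⟨ ∑-cong (λ y → cong₂ (λ m t → m * differences (1ᶠ +ᶠ t)) (h-neg y) (-ᶠ-involutive y)) ⟩
    ∑ (λ y → δ (ψ y) -1ᶠ * differences (1ᶠ +ᶠ y))                ≡⟨ energy-by-differences ⟩
    f + (A * A + (A * A + (E * E + (E * E + 0))))                ∎
    where
    h : F → ℕ
    h x = δ (ψ x) 1ᶠ
    h-neg : ∀ y → h (-ᶠ y) ≡ δ (ψ y) -1ᶠ
    h-neg y = δ-cong
      (λ eq → trans (sym (-ᶠ-involutive (ψ y))) (cong -ᶠ_ (trans (sym (ψ-neg y)) eq)))
      (λ eq → trans (ψ-neg y) (trans (cong -ᶠ_ eq) (-ᶠ-involutive 1ᶠ)))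
    swap* : ∀ a b c → a * (b * c) ≡ b * (a * c)
    swap* = ℕ-Ring.solve-∀
    regroup : ∀ b c → h b * (h c * h (1ᶠ +ᶠ b -ᶠ c)) ≡ h c * (h b * h (b +ᶠ (1ᶠ +ᶠ -ᶠ c)))
    regroup b c = trans (swap* (h b) (h c) _)
      (cong (λ t → h c * (h b * h t)) (solve 3 (λ u b c → (u :+ b) :- c := b :+ (u :+ :- c)) refl 1ᶠ b c))

-- The numerical consequence of C = 0.

2mn≤m²+n² : ∀ m n → 2 * (m * n) ≤ m * m + n * n
2mn≤m²+n² m n = Sum.[ ordered , (λ n≤m → ℕ.≤-trans (ℕ.≤-reflexive (cong (2 *_) (ℕ.*-comm m n))) (ℕ.≤-trans (ordered n≤m) (ℕ.≤-reflexive (ℕ.+-comm (n * n) (m * m))))) ]′ (ℕ.≤-total m n)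
  where
  identity : ∀ m d → 2 * (m * (m + d)) + d * d ≡ m * m + (m + d) * (m + d)
  identity = ℕ-Ring.solve-∀
  ordered : ∀ {m n} → m ≤ n → 2 * (m * n) ≤ m * m + n * n
  ordered {m} {n} m≤n = subst (λ n → 2 * (m * n) ≤ m * m + n * n) (ℕ.m+[n∸m]≡n m≤n)
    (ℕ.≤-trans (ℕ.m≤m+n _ _) (ℕ.≤-reflexive (identity m (n ∸ m))))

-- The three linear relations give A = 2E, f = 6E + 1 and B + D = 4E + 1;
-- then (B + D)² ≤ 2(B² + D²) reads 4E² ≤ 4E + 1.
few-cyclotomic-numbers : ∀ A B D E f →
  f ≡ A + (B + D) → f ≡ 1 + (A + A + (E + E)) → f ≡ E + E + (B + D) →
  A * A + (B * B + D * D) ≡ f + (A * A + A * A + (E * E + E * E)) → f ≡ 1 ⊎ f ≡ 7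
few-cyclotomic-numbers A B D E f r₁ r₂ r₃ energy = conclude E E≤1 f≡
  where
  A≡ : A ≡ E + E
  A≡ = ℕ.+-cancelʳ-≡ (B + D) A (E + E) (trans (sym r₁) r₃)
  f≡ : f ≡ 1 + 6 * E
  f≡ = trans r₂ (trans (cong (λ a → 1 + (a + a + (E + E))) A≡) (eq E))
    where
    eq : ∀ E → 1 + (E + E + (E + E) + (E + E)) ≡ 1 + 6 * E
    eq = ℕ-Ring.solve-∀
  B+D≡ : B + D ≡ 1 + 4 * E
  B+D≡ = ℕ.+-cancelˡ-≡ (E + E) _ _ (trans (sym r₃) (trans f≡ (eq E)))
    where
    eq : ∀ E → 1 + 6 * E ≡ E + E + (1 + 4 * E)
    eq = ℕ-Ring.solve-∀
  B²+D²≡ : B * B + D * D ≡ 1 + 6 * E + 6 * (E * E)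
  B²+D²≡ = ℕ.+-cancelˡ-≡ (A * A) _ _ (trans energy (trans (cong₂ (λ f a → f + (a * a + a * a + (E * E + E * E))) f≡ A≡) (trans (eq E) (cong (λ a → a * a + (1 + 6 * E + 6 * (E * E))) (sym A≡)))))
    where
    eq : ∀ E → 1 + 6 * E + ((E + E) * (E + E) + (E + E) * (E + E) + (E * E + E * E)) ≡ (E + E) * (E + E) + (1 + 6 * E + 6 * (E * E))
    eq = ℕ-Ring.solve-∀
  -- The gap 2 (B² + D²) - (B + D)² is (B - D)²; the inequality expresses its non-negativity without
  -- subtraction.
  bound : (1 + 4 * E) * (1 + 4 * E) ≤ 2 * (1 + 6 * E + 6 * (E * E))
  bound = subst (λ s → (1 + 4 * E) * (1 + 4 * E) ≤ 2 * s) B²+D²≡ (subst (λ s → s * s ≤ 2 * (B * B + D * D)) B+D≡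
    (ℕ.≤-trans (ℕ.≤-reflexive (eq B D)) (ℕ.≤-trans (ℕ.+-monoʳ-≤ (B * B + D * D) (2mn≤m²+n² B D)) (ℕ.≤-reflexive (eq′ (B * B + D * D))))))
    where
    eq : ∀ B D → (B + D) * (B + D) ≡ B * B + D * D + 2 * (B * D)
    eq = ℕ-Ring.solve-∀
    eq′ : ∀ s → s + s ≡ 2 * s
    eq′ = ℕ-Ring.solve-∀
  -- At E = 2 + e the polynomial 4E² - 4E - 1 equals 7 + 12e + 4e²; one of the 7 units accounts for
  -- strictness.
  too-big : ∀ e → 2 * (1 + 6 * (2 + e) + 6 * ((2 + e) * (2 + e))) < (1 + 4 * (2 + e)) * (1 + 4 * (2 + e))
  too-big e = ℕ.≤-trans (s≤s (ℕ.m≤m+n _ (6 + 12 * e + 4 * (e * e)))) (ℕ.≤-reflexive (eq e))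
    where
    eq : ∀ e → suc (2 * (1 + 6 * (2 + e) + 6 * ((2 + e) * (2 + e))) + (6 + 12 * e + 4 * (e * e))) ≡ (1 + 4 * (2 + e)) * (1 + 4 * (2 + e))
    eq = ℕ-Ring.solve-∀
  E≤1 : E ≤ 1
  E≤1 = ℕ.≮⇒≥ λ 1<E → ℕ.<⇒≱ (subst (λ E → 2 * (1 + 6 * E + 6 * (E * E)) < (1 + 4 * E) * (1 + 4 * E)) (ℕ.m+[n∸m]≡n 1<E) (too-big (E ∸ 2))) bound
  conclude : ∀ E → E ≤ 1 → f ≡ 1 + 6 * E → f ≡ 1 ⊎ f ≡ 7
  conclude zero          _         eq = inj₁ eq
  conclude (suc zero)    _         eq = inj₂ eq
  conclude (suc (suc _)) (s≤s ()) _

-- Zeros of sums of fourth powers modulo p.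

-- One term is normalised to 1⁴, so Isotropic n concerns sums of suc n fourth powers.
Isotropic : ℕ → ℕ → Set
Isotropic n p = Σ (Vec ℕ n) λ ys → p ℕ.∣ 1 + sum (map (_^ 4) ys)

module Solutions (p : ℕ) (p-prime : Prime p) where
  open PrimeField p p-prime
  open ≡-Reasoning

  ι-^ : ∀ n e → ι (+ (n ^ e)) ≡ ι (+ n) ^ᶠ e
  ι-^ n zero    = ι-1
  ι-^ n (suc e) = begin
    ι (+ (n * n ^ e))            ≡⟨ cong ι (ℤ.pos-* n (n ^ e)) ⟩
    ι (+ n ℤ.* + (n ^ e))        ≡⟨ ι-* _ _ ⟩
    ι (+ n) *ᶠ ι (+ (n ^ e))     ≡⟨ cong (ι (+ n) *ᶠ_) (ι-^ n e) ⟩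
    ι (+ n) *ᶠ ι (+ n) ^ᶠ e      ∎

  ι-toℕ-^4 : ∀ a → ι (+ (toℕ a ^ 4)) ≡ a ^ᶠ 4
  ι-toℕ-^4 a = trans (ι-^ (toℕ a) 4) (cong (_^ᶠ 4) (ι-lift a))

  ι≡0⇒∣ : ∀ {n} → ι (+ n) ≡ 0ᶠ → p ℕ.∣ n
  ι≡0⇒∣ eq = ℤ.∣⇒∣ᵤ (ι-≡0⇒∣ eq)

  ∣⇒ι≡0 : ∀ {n} → p ℕ.∣ n → ι (+ n) ≡ 0ᶠ
  ∣⇒ι≡0 d = ∣⇒ι-≡0 (ℤ.∣ᵤ⇒∣ d)

  isotropic₁ : ∀ {a} → a ^ᶠ 4 ≡ -ᶠ 1ᶠ → Isotropic 1 p
  isotropic₁ {a} eq = toℕ a ∷ [] , ι≡0⇒∣ (begin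
    ι (+ (1 + (toℕ a ^ 4 + 0)))   ≡⟨ cong (λ t → ι (+ (1 + t))) (ℕ.+-identityʳ _) ⟩
    ι (+ 1 ℤ.+ + (toℕ a ^ 4))     ≡⟨ ι-+ (+ 1) _ ⟩
    ι (+ 1) +ᶠ ι (+ (toℕ a ^ 4))  ≡⟨ cong₂ _+ᶠ_ ι-1 (trans (ι-toℕ-^4 a) eq) ⟩
    1ᶠ -ᶠ 1ᶠ                      ≡⟨ -ᶠ-inverseʳ 1ᶠ ⟩
    0ᶠ                            ∎)

  isotropic₂ : ∀ {a b} → 1ᶠ +ᶠ (a ^ᶠ 4 +ᶠ b ^ᶠ 4) ≡ 0ᶠ → Isotropic 2 p
  isotropic₂ {a} {b} eq = toℕ a ∷ toℕ b ∷ [] , ι≡0⇒∣ (begin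
    ι (+ (1 + (toℕ a ^ 4 + (toℕ b ^ 4 + 0))))                ≡⟨ cong (λ t → ι (+ (1 + (toℕ a ^ 4 + t)))) (ℕ.+-identityʳ _) ⟩
    ι (+ 1 ℤ.+ (+ (toℕ a ^ 4) ℤ.+ + (toℕ b ^ 4)))            ≡⟨ trans (ι-+ (+ 1) _) (cong₂ _+ᶠ_ ι-1 (ι-+ (+ (toℕ a ^ 4)) (+ (toℕ b ^ 4)))) ⟩
    1ᶠ +ᶠ (ι (+ (toℕ a ^ 4)) +ᶠ ι (+ (toℕ b ^ 4)))           ≡⟨ cong (1ᶠ +ᶠ_) (cong₂ _+ᶠ_ (ι-toℕ-^4 a) (ι-toℕ-^4 b)) ⟩
    1ᶠ +ᶠ (a ^ᶠ 4 +ᶠ b ^ᶠ 4)                                 ≡⟨ eq ⟩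
    0ᶠ                                                       ∎)

  -- As 3f² + 1 ≡ 0 (mod 4) for odd f, an element whose order divides f is the fourth power of its own (3f² + 1)/4-th power.
  fourth-root : ∀ k {x} → x ^ᶠ suc (2 * k) ≡ 1ᶠ → ∃[ a ] a ^ᶠ 4 ≡ x
  fourth-root k {x} eq = x ^ᶠ m , (begin
    (x ^ᶠ m) ^ᶠ 4               ≡⟨ ^ᶠ-assocʳ x m 4 ⟩
    x ^ᶠ (m * 4)                ≡⟨ cong (x ^ᶠ_) (exponent k) ⟩
    x ^ᶠ suc (f * (3 * f))      ≡⟨ cong (x *ᶠ_) (sym (^ᶠ-assocʳ x f (3 * f))) ⟩
    x *ᶠ (x ^ᶠ f) ^ᶠ (3 * f)    ≡⟨ cong (λ t → x *ᶠ t ^ᶠ (3 * f)) eq ⟩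
    x *ᶠ 1ᶠ ^ᶠ (3 * f)          ≡⟨ cong (x *ᶠ_) (1^ᶠ (3 * f)) ⟩
    x *ᶠ 1ᶠ                     ≡⟨ *ᶠ-identityʳ x ⟩
    x                           ∎)
    where
    f m : ℕ
    f = suc (2 * k)
    m = 1 + 3 * (k * suc k)
    exponent : ∀ k → (1 + 3 * (k * suc k)) * 4 ≡ suc (suc (2 * k) * (3 * suc (2 * k)))
    exponent = ℕ-Ring.solve-∀

  -- The exponent f = 2k + 1 is odd, so -(1 + y) also has f-th power 1, and `fourth-root` applies to
  -- it and to y. It serves with f = (p - 1)/4 for p ≡ 5 (mod 8) and with f = (p - 1)/2 for p ≡ 3
  -- (mod 4).
  isotropic-of-consecutive : ∀ k {y} → y ^ᶠ suc (2 * k) ≡ 1ᶠ → (1ᶠ +ᶠ y) ^ᶠ suc (2 * k) ≡ -ᶠ 1ᶠ → Isotropic 2 p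
  isotropic-of-consecutive k {y} eq eq′ = isotropic₂ (begin
    1ᶠ +ᶠ (proj₁ a ^ᶠ 4 +ᶠ proj₁ b ^ᶠ 4)  ≡⟨ cong (1ᶠ +ᶠ_) (cong₂ _+ᶠ_ (proj₂ a) (proj₂ b)) ⟩
    1ᶠ +ᶠ (y -ᶠ (1ᶠ +ᶠ y))                ≡⟨ solve 2 (λ u y → u :+ (y :- (u :+ y)) := con (+ 0)) refl 1ᶠ y ⟩
    ι (+ 0)                               ≡⟨ ι-0 ⟩
    0ᶠ                                    ∎)
    where
    a : ∃[ a ] a ^ᶠ 4 ≡ y
    a = fourth-root k eq
    b : ∃[ b ] b ^ᶠ 4 ≡ -ᶠ (1ᶠ +ᶠ y)
    b = fourth-root k (trans (neg-^-odd k _) (trans (cong -ᶠ_ eq′) (-ᶠ-involutive 1ᶠ)))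

  -- For a nonresidue x, Euler's criterion reads x^(4(q + 1)) = -1, so x^(q + 1) is a fourth root of
  -- -1.
  isotropic-1mod8 : ∀ q → p ≡ suc (8 * suc q) → Isotropic 1 p
  isotropic-1mod8 q p≡ = isotropic₁ (trans (^ᶠ-assocʳ x (suc q) 4) (trans (cong (x ^ᶠ_) (ℕ.*-comm (suc q) 4)) (proj₂ (proj₂ found))))
    where
    shape : ∀ q → 8 * suc q ≡ 2 * (4 * suc q)
    shape = ℕ-Ring.solve-∀
    found : ∃[ x ] (x ≢ 0ᶠ × x ^ᶠ (4 * suc q) ≡ -ᶠ 1ᶠ)
    found = nonresidue (q + 3 * suc q) (trans p≡ (cong suc (shape q)))
    x : F
    x = proj₁ found

  -- Here ψ is the Legendre symbol. It is -1 at p - 1 = 2f and 0 at 0, so going down from 2f there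
  -- is an n with ψ (n + 1) = -1 and ψ n ≠ -1.
  isotropic-3mod4 : ∀ k → p ≡ suc (2 * suc (2 * k)) → Isotropic 2 p
  isotropic-3mod4 k p≡ = let n , not , yes′ = jump (2 * f) ψ-last in
      isotropic-of-consecutive k (ψ≡1 n not yes′) (trans (cong ψ (sym (ι-suc n))) yes′)
    where
    f : ℕ
    f = suc (2 * k)
    ψ : F → F
    ψ x = x ^ᶠ f
    2<p : 2 < p
    2<p = subst (2 <_) (sym p≡) (s≤s (ℕ.*-monoʳ-≤ 2 {1} {f} (s≤s z≤n)))
    ι-suc : ∀ n → ι (+ suc n) ≡ 1ᶠ +ᶠ ι (+ n)
    ι-suc n = trans (ι-+ (+ 1) (+ n)) (cong (_+ᶠ ι (+ n)) ι-1)
    ψ-last : ψ (ι (+ (2 * f))) ≡ -ᶠ 1ᶠ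
    ψ-last = trans (cong ψ (1+≡0⇒≡-1 (begin
      1ᶠ +ᶠ ι (+ (2 * f))      ≡⟨ sym (ι-suc (2 * f)) ⟩
      ι (+ suc (2 * f))        ≡⟨ ∣⇒ι≡0 (subst (p ℕ.∣_) p≡ ℕ.∣-refl) ⟩
      0ᶠ                       ∎))) (-1^odd k)
    jump : ∀ n → ψ (ι (+ n)) ≡ -ᶠ 1ᶠ → ∃[ m ] (ψ (ι (+ m)) ≢ -ᶠ 1ᶠ × ψ (ι (+ suc m)) ≡ -ᶠ 1ᶠ)
    jump zero    eq = contradiction (trans (sym eq) (trans (cong ψ ι-0) (0^ᶠ f))) -1≢0
    jump (suc n) eq = by-cases (ψ (ι (+ n)) Finₚ.≟ -ᶠ 1ᶠ)
      where
      by-cases : Dec (ψ (ι (+ n)) ≡ -ᶠ 1ᶠ) → ∃[ m ] (ψ (ι (+ m)) ≢ -ᶠ 1ᶠ × ψ (ι (+ suc m)) ≡ -ᶠ 1ᶠ)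
      by-cases (yes eq′) = jump n eq′
      by-cases (no ne)    = n , ne , eq
    ψ≡1 : ∀ n → ψ (ι (+ n)) ≢ -ᶠ 1ᶠ → ψ (ι (+ suc n)) ≡ -ᶠ 1ᶠ → ψ (ι (+ n)) ≡ 1ᶠ
    ψ≡1 n ne eq = Sum.[ (λ e → e) , (λ e → contradiction e ne) ]′ (square≡1 (begin
      ψ x *ᶠ ψ x      ≡⟨ sym (^ᶠ-homo-* x f f) ⟩
      x ^ᶠ (f + f)    ≡⟨ cong (x ^ᶠ_) (trans (cong (f ℕ.+_) (sym (ℕ.+-identityʳ f))) (cong (_∸ 1) (sym p≡))) ⟩
      x ^ᶠ (p ∸ 1)    ≡⟨ fermat x≢0 ⟩
      1ᶠ              ∎))
      where
      x : F
      x = ι (+ n)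
      -- The value ψ n = 0 is excluded too: the successor of 0 is 1, whose symbol is 1.
      x≢0 : x ≢ 0ᶠ
      x≢0 x≡0 = 1≢-1 2<p (begin
        1ᶠ              ≡⟨ sym (1^ᶠ f) ⟩
        ψ 1ᶠ            ≡⟨ cong ψ (sym (+ᶠ-identityʳ 1ᶠ)) ⟩
        ψ (1ᶠ +ᶠ 0ᶠ)    ≡⟨ cong (λ t → ψ (1ᶠ +ᶠ t)) (sym x≡0) ⟩
        ψ (1ᶠ +ᶠ x)     ≡⟨ cong ψ (sym (ι-suc n)) ⟩
        ψ (ι (+ suc n)) ≡⟨ eq ⟩
        -ᶠ 1ᶠ           ∎)

  isotropic-5mod8 : ∀ k → p ≡ suc (4 * suc (2 * k)) → p ≢ 5 → p ≢ 29 → Isotropic 2 p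
  isotropic-5mod8 k p≡ p≢5 p≢29 = by-cases (Finₚ.any? (λ y → (ψ y Finₚ.≟ 1ᶠ) ×-dec (ψ (1ᶠ +ᶠ y) Finₚ.≟ -ᶠ 1ᶠ)))
    where
    open Quartic p p-prime k p≡ using (ψ; A; B; C; D; E; f; row-1; row-neg1; row-i; energy)
    by-cases : Dec (∃[ y ] (ψ y ≡ 1ᶠ × ψ (1ᶠ +ᶠ y) ≡ -ᶠ 1ᶠ)) → Isotropic 2 p
    by-cases (yes (y , eq , eq′)) = isotropic-of-consecutive k eq eq′
    by-cases (no none) = contradiction (few-cyclotomic-numbers A B D E f r₁ r₂ r₃ e)
      Sum.[ (λ f≡1 → p≢5 (trans p≡ (cong (λ f → suc (4 * f)) f≡1))) , (λ f≡7 → p≢29 (trans p≡ (cong (λ f → suc (4 * f)) f≡7))) ]′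
      where
      C≡0 : C ≡ 0
      C≡0 = trans (∑-cong (λ y → trans (δ-*-cong (λ eq → δ-≢ (λ eq′ → none (y , eq , eq′)))) (ℕ.*-zeroʳ (δ (ψ y) 1ᶠ)))) (∑.sum-replicate-zero p)
      s₁ : ∀ A B D → A + (0 + (B + (D + 0))) ≡ A + (B + D)
      s₁ = ℕ-Ring.solve-∀
      r₁ : f ≡ A + (B + D)
      r₁ = trans row-1 (trans (cong (λ c → A + (c + (B + (D + 0)))) C≡0) (s₁ A B D))
      s₂ : ∀ A E → 1 + (A + (A + (E + (E + 0)))) ≡ 1 + (A + A + (E + E))
      s₂ = ℕ-Ring.solve-∀
      r₂ : f ≡ 1 + (A + A + (E + E))
      r₂ = trans row-neg1 (s₂ A E)
      s₃ : ∀ B D E → E + (D + (E + (B + 0))) ≡ E + E + (B + D)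
      s₃ = ℕ-Ring.solve-∀
      r₃ : f ≡ E + E + (B + D)
      r₃ = trans row-i (s₃ B D E)
      s₄ : ∀ a b d → a + (0 + (b + (d + 0))) ≡ a + (b + d)
      s₄ = ℕ-Ring.solve-∀
      s₅ : ∀ f a e → f + (a + (a + (e + (e + 0)))) ≡ f + (a + a + (e + e))
      s₅ = ℕ-Ring.solve-∀
      e : A * A + (B * B + D * D) ≡ f + (A * A + A * A + (E * E + E * E))
      e = trans (sym (trans (cong (λ c → A * A + (c * c + (B * B + (D * D + 0)))) C≡0) (s₄ (A * A) (B * B) (D * D)))) (trans energy (s₅ f (A * A) (E * E)))

  -- 4f is a multiple of p - 1 with f odd, so x⁴ = -y⁴ raised to the power f reads 1 = -1.
  no-sum-of-two : 2 < p → ∀ k j → 4 * suc (2 * k) ≡ (p ∸ 1) * j →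
                  ∀ x y → p ℕ.∣ x ^ 4 + y ^ 4 → p ℕ.∣ y
  no-sum-of-two 2<p k j 4f≡ x y d = by-cases (b Finₚ.≟ 0ᶠ)
    where
    f : ℕ
    f = suc (2 * k)
    a b : F
    a = ι (+ x)
    b = ι (+ y)
    sum≡0 : a ^ᶠ 4 +ᶠ b ^ᶠ 4 ≡ 0ᶠ
    sum≡0 = trans (sym (cong₂ _+ᶠ_ (ι-^ x 4) (ι-^ y 4))) (trans (sym (ι-+ _ _)) (∣⇒ι≡0 d))
    a^4≡ : a ^ᶠ 4 ≡ -ᶠ (b ^ᶠ 4)
    a^4≡ = -ᶠ-≡0⇒≡ (trans (cong (a ^ᶠ 4 +ᶠ_) (-ᶠ-involutive _)) sum≡0)
    ^4f : ∀ {c} → c ≢ 0ᶠ → (c ^ᶠ 4) ^ᶠ f ≡ 1ᶠ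
    ^4f {c} c≢0 = begin
      (c ^ᶠ 4) ^ᶠ f         ≡⟨ ^ᶠ-assocʳ c 4 f ⟩
      c ^ᶠ (4 * f)          ≡⟨ cong (c ^ᶠ_) 4f≡ ⟩
      c ^ᶠ ((p ∸ 1) * j)    ≡⟨ sym (^ᶠ-assocʳ c (p ∸ 1) j) ⟩
      (c ^ᶠ (p ∸ 1)) ^ᶠ j   ≡⟨ cong (_^ᶠ j) (fermat c≢0) ⟩
      1ᶠ ^ᶠ j               ≡⟨ 1^ᶠ j ⟩
      1ᶠ                    ∎
    by-cases : Dec (b ≡ 0ᶠ) → p ℕ.∣ y
    by-cases (yes b≡0) = ι≡0⇒∣ b≡0
    by-cases (no b≢0)  = contradiction (begin
      1ᶠ                    ≡⟨ sym (^4f a≢0) ⟩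
      (a ^ᶠ 4) ^ᶠ f         ≡⟨ cong (_^ᶠ f) a^4≡ ⟩
      (-ᶠ (b ^ᶠ 4)) ^ᶠ f    ≡⟨ neg-^-odd k (b ^ᶠ 4) ⟩
      -ᶠ ((b ^ᶠ 4) ^ᶠ f)    ≡⟨ cong -ᶠ_ (^4f b≢0) ⟩
      -ᶠ 1ᶠ                 ∎) (1≢-1 2<p)
      where
      a≢0 : a ≢ 0ᶠ
      a≢0 a≡0 = ^ᶠ-≢0 4 b≢0 (begin
        b ^ᶠ 4               ≡⟨ sym (+ᶠ-identityˡ _) ⟩
        0ᶠ +ᶠ b ^ᶠ 4         ≡⟨ cong (_+ᶠ b ^ᶠ 4) (sym (trans (cong (_^ᶠ 4) a≡0) (0^ᶠ 4))) ⟩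
        a ^ᶠ 4 +ᶠ b ^ᶠ 4     ≡⟨ sum≡0 ⟩
        0ᶠ                   ∎)

-- Integers and fractions inside the rationals.

toℚᵘ-/ : ∀ z n .{{_ : NonZero n}} → ℚ.toℚᵘ (z ℚ./ n) ℚᵘ.≃ z ℚᵘ./ n
toℚᵘ-/ z n@(suc _) = ℚ.toℚᵘ-fromℚᵘ (z ℚᵘ./ n)

/-*-cancel : ∀ z n .{{_ : NonZero n}} → (z ℚ./ n) ℚ.* ℕ→ℚ n ≡ ℤ→ℚ z
/-*-cancel z n@(suc _) = ℚ.toℚᵘ-injective (begin
  ℚ.toℚᵘ ((z ℚ./ n) ℚ.* (+ n ℚ./ 1))           ≈⟨ ℚ.toℚᵘ-homo-* (z ℚ./ n) (+ n ℚ./ 1) ⟩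
  ℚ.toℚᵘ (z ℚ./ n) ℚᵘ.* ℚ.toℚᵘ (+ n ℚ./ 1)     ≈⟨ ℚᵘ.*-cong (toℚᵘ-/ z n) (toℚᵘ-/ (+ n) 1) ⟩
  (z ℚᵘ./ n) ℚᵘ.* (+ n ℚᵘ./ 1)                 ≈⟨ *≡* (eq z (+ n)) ⟩
  z ℚᵘ./ 1                                     ≈⟨ ℚᵘ.≃-sym (toℚᵘ-/ z 1) ⟩
  ℚ.toℚᵘ (z ℚ./ 1)                             ∎)
  where
  open SetoidReasoning ℚᵘ.≃-setoid
  eq : ∀ z n → z ℤ.* n ℤ.* + 1 ≡ z ℤ.* (n ℤ.* + 1)
  eq = solve-∀

ℤ→ℚ-* : ∀ z w → ℤ→ℚ (z ℤ.* w) ≡ ℤ→ℚ z ℚ.* ℤ→ℚ w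
ℤ→ℚ-* z w = ℚ.toℚᵘ-injective (begin
  ℚ.toℚᵘ (ℤ→ℚ (z ℤ.* w))                ≈⟨ toℚᵘ-/ (z ℤ.* w) 1 ⟩
  (z ℤ.* w) ℚᵘ./ 1                       ≈⟨ *≡* refl ⟩
  (z ℚᵘ./ 1) ℚᵘ.* (w ℚᵘ./ 1)             ≈⟨ ℚᵘ.≃-sym (ℚᵘ.*-cong (toℚᵘ-/ z 1) (toℚᵘ-/ w 1)) ⟩
  ℚ.toℚᵘ (ℤ→ℚ z) ℚᵘ.* ℚ.toℚᵘ (ℤ→ℚ w)     ≈⟨ ℚᵘ.≃-sym (ℚ.toℚᵘ-homo-* (ℤ→ℚ z) (ℤ→ℚ w)) ⟩
  ℚ.toℚᵘ (ℤ→ℚ z ℚ.* ℤ→ℚ w)               ∎)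
  where open SetoidReasoning ℚᵘ.≃-setoid

ℤ→ℚ-+ : ∀ z w → ℤ→ℚ (z ℤ.+ w) ≡ ℤ→ℚ z ℚ.+ ℤ→ℚ w
ℤ→ℚ-+ z w = ℚ.toℚᵘ-injective (begin
  ℚ.toℚᵘ (ℤ→ℚ (z ℤ.+ w))                ≈⟨ toℚᵘ-/ (z ℤ.+ w) 1 ⟩
  (z ℤ.+ w) ℚᵘ./ 1                       ≈⟨ *≡* (eq z w) ⟩
  (z ℚᵘ./ 1) ℚᵘ.+ (w ℚᵘ./ 1)             ≈⟨ ℚᵘ.≃-sym (ℚᵘ.+-cong (toℚᵘ-/ z 1) (toℚᵘ-/ w 1)) ⟩
  ℚ.toℚᵘ (ℤ→ℚ z) ℚᵘ.+ ℚ.toℚᵘ (ℤ→ℚ w)     ≈⟨ ℚᵘ.≃-sym (ℚ.toℚᵘ-homo-+ (ℤ→ℚ z) (ℤ→ℚ w)) ⟩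
  ℚ.toℚᵘ (ℤ→ℚ z ℚ.+ ℤ→ℚ w)               ∎)
  where
  open SetoidReasoning ℚᵘ.≃-setoid
  eq : ∀ z w → (z ℤ.+ w) ℤ.* + 1 ≡ (z ℤ.* + 1 ℤ.+ w ℤ.* + 1) ℤ.* + 1
  eq = solve-∀

ℤ→ℚ-injective : ∀ {z w} → ℤ→ℚ z ≡ ℤ→ℚ w → z ≡ w
ℤ→ℚ-injective {z} {w} eq = unit (begin
  z ℚᵘ./ 1          ≈⟨ ℚᵘ.≃-sym (toℚᵘ-/ z 1) ⟩
  ℚ.toℚᵘ (ℤ→ℚ z)    ≈⟨ ℚᵘ.≃-reflexive (cong ℚ.toℚᵘ eq) ⟩
  ℚ.toℚᵘ (ℤ→ℚ w)    ≈⟨ toℚᵘ-/ w 1 ⟩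
  w ℚᵘ./ 1          ∎)
  where
  open SetoidReasoning ℚᵘ.≃-setoid
  unit : z ℚᵘ./ 1 ℚᵘ.≃ w ℚᵘ./ 1 → z ≡ w
  unit (*≡* eq) = trans (sym (ℤ.*-identityʳ z)) (trans eq (ℤ.*-identityʳ w))

*-cancelʳ-ℚ : ∀ {x y} n .{{_ : NonZero n}} → x ℚ.* ℕ→ℚ n ≡ y ℚ.* ℕ→ℚ n → x ≡ y
*-cancelʳ-ℚ {x} {y} n eq = begin
  x                                   ≡⟨ sym (ℚ.*-identityʳ x) ⟩
  x ℚ.* ℚ.1ℚ                          ≡⟨ cong (x ℚ.*_) (sym n*n⁻¹) ⟩
  x ℚ.* (ℕ→ℚ n ℚ.* n⁻¹)               ≡⟨ sym (ℚ.*-assoc x _ _) ⟩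
  x ℚ.* ℕ→ℚ n ℚ.* n⁻¹                 ≡⟨ cong (ℚ._* n⁻¹) eq ⟩
  y ℚ.* ℕ→ℚ n ℚ.* n⁻¹                 ≡⟨ ℚ.*-assoc y _ _ ⟩
  y ℚ.* (ℕ→ℚ n ℚ.* n⁻¹)               ≡⟨ cong (y ℚ.*_) n*n⁻¹ ⟩
  y ℚ.* ℚ.1ℚ                          ≡⟨ ℚ.*-identityʳ y ⟩
  y                                   ∎
  where
  open ≡-Reasoning
  n⁻¹ : ℚ
  n⁻¹ = + 1 ℚ./ n
  n*n⁻¹ : ℕ→ℚ n ℚ.* n⁻¹ ≡ ℚ.1ℚ
  n*n⁻¹ = trans (ℚ.*-comm (ℕ→ℚ n) n⁻¹) (/-*-cancel (+ 1) n)

-- This is a/b - u/v = (a v - u b)/(b v) with denominators cleared, so that only products occur.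
fraction-approximation : ∀ {r x a b u v w N} → r ℚ.* ℕ→ℚ b ≡ ℤ→ℚ a → x ℚ.* ℕ→ℚ v ≡ ℤ→ℚ u →
  a ℤ.* + v ≡ u ℤ.* + b ℤ.+ N ℤ.* w → (r ℚ.- x) ℚ.* ℕ→ℚ (b * v) ≡ ℤ→ℚ N ℚ.* ℤ→ℚ w
fraction-approximation {r} {x} {a} {b} {u} {v} {w} {N} rb≡a xv≡u eq = begin
  (r ℚ.- x) ℚ.* ℕ→ℚ (b * v)                                   ≡⟨ cong ((r ℚ.- x) ℚ.*_) (trans (cong ℤ→ℚ (ℤ.pos-* b v)) (ℤ→ℚ-* (+ b) (+ v))) ⟩
  (r ℚ.- x) ℚ.* (ℕ→ℚ b ℚ.* ℕ→ℚ v)                             ≡⟨ solve 4 (λ r x b v → (r :- x) :* (b :* v) := r :* b :* v :- x :* v :* b) refl r x (ℕ→ℚ b) (ℕ→ℚ v) ⟩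
  r ℚ.* ℕ→ℚ b ℚ.* ℕ→ℚ v ℚ.- x ℚ.* ℕ→ℚ v ℚ.* ℕ→ℚ b             ≡⟨ cong₂ (λ s t → s ℚ.* ℕ→ℚ v ℚ.- t ℚ.* ℕ→ℚ b) rb≡a xv≡u ⟩
  ℤ→ℚ a ℚ.* ℕ→ℚ v ℚ.- ℤ→ℚ u ℚ.* ℕ→ℚ b                         ≡⟨ cong (ℚ._- ℤ→ℚ u ℚ.* ℕ→ℚ b) (trans (sym (ℤ→ℚ-* a (+ v))) (trans (cong ℤ→ℚ eq) (trans (ℤ→ℚ-+ (u ℤ.* + b) (N ℤ.* w)) (cong₂ ℚ._+_ (ℤ→ℚ-* u (+ b)) (ℤ→ℚ-* N w))))) ⟩
  ℤ→ℚ u ℚ.* ℕ→ℚ b ℚ.+ ℤ→ℚ N ℚ.* ℤ→ℚ w ℚ.- ℤ→ℚ u ℚ.* ℕ→ℚ b     ≡⟨ solve 2 (λ s t → s :+ t :- s := t) refl (ℤ→ℚ u ℚ.* ℕ→ℚ b) (ℤ→ℚ N ℚ.* ℤ→ℚ w) ⟩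
  ℤ→ℚ N ℚ.* ℤ→ℚ w                                             ∎
  where
  open ≡-Reasoning
  open ℚ.+-*-Solver

-- Newton iteration and density.

pow4 : ℤ → ℤ
pow4 x = x ℤ.* x ℤ.* x ℤ.* x

-- The iteration yields integers of either sign, while `InS4` asks for naturals; a fourth power
-- forgets the sign.
pos-∣∣^4 : ∀ x → + (ℤ.∣ x ∣ ^ 4) ≡ pow4 x
pos-∣∣^4 x = trans pos-^4 (Sum.[ cong pow4 , (λ eq → trans (cong pow4 eq) (neg-pow4 x)) ]′ (ℤ.+∣i∣≡i⊎+∣i∣≡-i x))
  where
  open ≡-Reasoning
  m : ℕ
  m = ℤ.∣ x ∣
  nest : ∀ m → m * (m * (m * (m * 1))) ≡ m * m * m * m
  nest = ℕ-Ring.solve-∀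
  pos-^4 : + (m ^ 4) ≡ pow4 (+ m)
  pos-^4 = begin
    + (m ^ 4)                      ≡⟨ cong +_ (nest m) ⟩
    + (m * m * m * m)              ≡⟨ ℤ.pos-* (m * m * m) m ⟩
    + (m * m * m) ℤ.* + m          ≡⟨ cong (ℤ._* + m) (ℤ.pos-* (m * m) m) ⟩
    + (m * m) ℤ.* + m ℤ.* + m      ≡⟨ cong (λ t → t ℤ.* + m ℤ.* + m) (ℤ.pos-* m m) ⟩
    pow4 (+ m)                     ∎
  neg-pow4 : ∀ x → (ℤ.- x) ℤ.* (ℤ.- x) ℤ.* (ℤ.- x) ℤ.* (ℤ.- x) ≡ x ℤ.* x ℤ.* x ℤ.* x
  neg-pow4 = solve-∀

module Density (p : ℕ) (p-prime : Prime p) (l : ℕ) (p≡1+2l : p ≡ suc (2 * l)) where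

  instance
    p-nonZero : NonZero p
    p-nonZero = prime⇒nonZero p-prime

  -- From 2l ≡ -1 (mod p) by squaring; l² thus serves as an explicit inverse of 4.
  4l²≡1 : + p ℤ.∣ + 4 ℤ.* (+ l ℤ.* + l) ℤ.- + 1
  4l²≡1 = divides (+ 2 ℤ.* + l ℤ.- + 1) (trans (eq (+ l)) (cong ((+ 2 ℤ.* + l ℤ.- + 1) ℤ.*_) (sym p≡)))
    where
    p≡ : + p ≡ + 1 ℤ.+ + 2 ℤ.* + l
    p≡ = trans (cong +_ p≡1+2l) (cong (λ t → + 1 ℤ.+ t) (ℤ.pos-* 2 l))
    eq : ∀ l → + 4 ℤ.* (l ℤ.* l) ℤ.- + 1 ≡ (+ 2 ℤ.* l ℤ.- + 1) ℤ.* (+ 1 ℤ.+ + 2 ℤ.* l)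
    eq = solve-∀

  -- Newton iteration for X⁴ = c starting at 1; l² inverts the derivative 4X³ because 4l² ≡ X ≡ 1 (mod p).
  fourth-root-lift : ∀ c → + p ℤ.∣ + 1 ℤ.- c → ∀ j → ∃[ x ] (+ p ℤ.∣ x ℤ.- + 1 × + (p ^ suc j) ℤ.∣ pow4 x ℤ.- c)
  fourth-root-lift c h zero = + 1 , divides (+ 0) refl , subst (λ n → + n ℤ.∣ + 1 ℤ.- c) (sym (ℕ.*-identityʳ p)) h
  fourth-root-lift c h (suc j) = let x , x≡1 , x⁴≡c = fourth-root-lift c h j in step x x≡1 x⁴≡c
    where
    N : ℤ
    N = + (p ^ suc j)
    N≡ : N ≡ + p ℤ.* + (p ^ j)
    N≡ = ℤ.pos-* p (p ^ j)
    step : ∀ x → + p ℤ.∣ x ℤ.- + 1 → N ℤ.∣ pow4 x ℤ.- c →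
           ∃[ x ] (+ p ℤ.∣ x ℤ.- + 1 × + (p ^ suc (suc j)) ℤ.∣ pow4 x ℤ.- c)
    step x x≡1 (divides m x⁴-c≡mN) = x ℤ.+ τ ℤ.* N ,
        subst (+ p ℤ.∣_) (sym (split x (τ ℤ.* N))) (ℤ.∣m∣n⇒∣m+n x≡1 (ℤ.∣n⇒∣m*n τ p∣N)) ,
        subst (_ ℤ.∣_) (sym taylor) (subst (ℤ._∣ N ℤ.* Z) (sym pN≡) (ℤ.*-monoʳ-∣ N p∣Z))
      where
      open ≡-Reasoning
      τ R Z : ℤ
      -- The Newton correction -m/(4x³) modulo p. The Taylor terms of order at least two add up to
      -- N² R, and N Z is the new error.
      τ = ℤ.- (m ℤ.* (+ l ℤ.* + l))
      R = + 6 ℤ.* (x ℤ.* x) ℤ.* (τ ℤ.* τ) ℤ.+ + 4 ℤ.* x ℤ.* (τ ℤ.* τ ℤ.* τ) ℤ.* N ℤ.+ (τ ℤ.* τ ℤ.* τ ℤ.* τ) ℤ.* (N ℤ.* N)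
      Z = m ℤ.+ + 4 ℤ.* (x ℤ.* x ℤ.* x) ℤ.* τ ℤ.+ N ℤ.* R
      split : ∀ x t → x ℤ.+ t ℤ.- + 1 ≡ (x ℤ.- + 1) ℤ.+ t
      split = solve-∀
      p∣N : + p ℤ.∣ N
      p∣N = divides (+ (p ^ j)) (trans N≡ (ℤ.*-comm (+ p) _))
      pN≡ : + (p ^ suc (suc j)) ≡ N ℤ.* + p
      pN≡ = trans (ℤ.pos-* p (p ^ suc j)) (ℤ.*-comm (+ p) N)
      p∣x³-1 : + p ℤ.∣ x ℤ.* x ℤ.* x ℤ.- + 1
      p∣x³-1 = subst (+ p ℤ.∣_) (sym (eq x)) (ℤ.∣m⇒∣m*n (x ℤ.* x ℤ.+ x ℤ.+ + 1) x≡1)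
        where
        eq : ∀ x → x ℤ.* x ℤ.* x ℤ.- + 1 ≡ (x ℤ.- + 1) ℤ.* (x ℤ.* x ℤ.+ x ℤ.+ + 1)
        eq = solve-∀
      p∣linear : + p ℤ.∣ m ℤ.+ + 4 ℤ.* (x ℤ.* x ℤ.* x) ℤ.* τ
      p∣linear = subst (+ p ℤ.∣_) (sym (eq m (+ l) (x ℤ.* x ℤ.* x)))
        (ℤ.∣n⇒∣m*n (ℤ.- m) (ℤ.∣m∣n⇒∣m+n p∣x³-1 (ℤ.∣m⇒∣m*n (x ℤ.* x ℤ.* x) 4l²≡1)))
        where
        eq : ∀ m l y → m ℤ.+ + 4 ℤ.* y ℤ.* ℤ.- (m ℤ.* (l ℤ.* l)) ≡ ℤ.- m ℤ.* ((y ℤ.- + 1) ℤ.+ (+ 4 ℤ.* (l ℤ.* l) ℤ.- + 1) ℤ.* y)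
        eq = solve-∀
      p∣Z : + p ℤ.∣ Z
      p∣Z = ℤ.∣m∣n⇒∣m+n p∣linear (ℤ.∣m⇒∣m*n R p∣N)
      taylor : pow4 (x ℤ.+ τ ℤ.* N) ℤ.- c ≡ N ℤ.* Z
      taylor = begin
        pow4 (x ℤ.+ τ ℤ.* N) ℤ.- c
          ≡⟨ expand x τ N c ⟩
        (pow4 x ℤ.- c) ℤ.+ N ℤ.* (+ 4 ℤ.* (x ℤ.* x ℤ.* x) ℤ.* τ ℤ.+ N ℤ.* R)
          ≡⟨ cong (ℤ._+ N ℤ.* (+ 4 ℤ.* (x ℤ.* x ℤ.* x) ℤ.* τ ℤ.+ N ℤ.* R)) x⁴-c≡mN ⟩
        m ℤ.* N ℤ.+ N ℤ.* (+ 4 ℤ.* (x ℤ.* x ℤ.* x) ℤ.* τ ℤ.+ N ℤ.* R)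
          ≡⟨ collect m N (+ 4 ℤ.* (x ℤ.* x ℤ.* x) ℤ.* τ) (N ℤ.* R) ⟩
        N ℤ.* Z ∎
        where
        expand : ∀ x τ N c →
          (x ℤ.+ τ ℤ.* N) ℤ.* (x ℤ.+ τ ℤ.* N) ℤ.* (x ℤ.+ τ ℤ.* N) ℤ.* (x ℤ.+ τ ℤ.* N) ℤ.- c ≡
          (x ℤ.* x ℤ.* x ℤ.* x ℤ.- c) ℤ.+ N ℤ.* (+ 4 ℤ.* (x ℤ.* x ℤ.* x) ℤ.* τ ℤ.+ N ℤ.* (+ 6 ℤ.* (x ℤ.* x) ℤ.* (τ ℤ.* τ) ℤ.+ + 4 ℤ.* x ℤ.* (τ ℤ.* τ ℤ.* τ) ℤ.* N ℤ.+ (τ ℤ.* τ ℤ.* τ ℤ.* τ) ℤ.* (N ℤ.* N)))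
        expand = solve-∀
        collect : ∀ m N a b → m ℤ.* N ℤ.+ N ℤ.* (a ℤ.+ b) ≡ N ℤ.* (m ℤ.+ a ℤ.+ b)
        collect = solve-∀

  ∤-* : ∀ {m n} → ¬ p ℕ.∣ m → ¬ p ℕ.∣ n → ¬ p ℕ.∣ m * n
  ∤-* {m} {n} p∤m p∤n p∣mn = Sum.[ p∤m , p∤n ]′ (euclidsLemma m n p-prime p∣mn)

  p-part : ∀ n .{{_ : NonZero n}} → ∃[ e ] ∃[ n′ ] (n ≡ p ^ e * n′ × ¬ p ℕ.∣ n′)
  p-part n = go n (ℕ.<-wellFounded n)
    where
    go : ∀ n .{{_ : NonZero n}} → Acc _<_ n → ∃[ e ] ∃[ n′ ] (n ≡ p ^ e * n′ × ¬ p ℕ.∣ n′)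
    go n (acc rec) = by-cases (p ℕ.∣? n)
      where
      by-cases : Dec (p ℕ.∣ n) → ∃[ e ] ∃[ n′ ] (n ≡ p ^ e * n′ × ¬ p ℕ.∣ n′)
      by-cases (no p∤n)  = 0 , n , sym (ℕ.+-identityʳ n) , p∤n
      by-cases (yes p∣n) = suc e , n′ , n≡ , p∤n′
        where
        instance
          q-nonZero : NonZero (ℕ.quotient p∣n)
          q-nonZero = ℕ.quotient≢0 p∣n
          p-nonTrivial : ℕ.NonTrivial p
          p-nonTrivial = prime⇒nonTrivial p-prime
        rest = go (ℕ.quotient p∣n) (rec (ℕ.quotient-< p∣n))
        e = proj₁ rest
        n′ = proj₁ (proj₂ rest)
        p∤n′ = proj₂ (proj₂ (proj₂ rest))
        n≡ : n ≡ p ^ suc e * n′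
        n≡ = begin
          n                      ≡⟨ ℕ.m∣n⇒n≡m*quotient p∣n ⟩
          p * ℕ.quotient p∣n     ≡⟨ cong (p *_) (proj₁ (proj₂ (proj₂ rest))) ⟩
          p * (p ^ e * n′)       ≡⟨ sym (ℕ.*-assoc p (p ^ e) n′) ⟩
          p ^ suc e * n′         ∎
          where open ≡-Reasoning

  -- With s the sum of the given fourth powers, isotropy says -s ≡ 1 (mod p). Hence c = p t - s is
  -- also ≡ 1, and 1 lifts to an approximate fourth root of c. A multiple of p as target is what
  -- keeps c in the class of 1.
  approximate : ∀ {n} → Isotropic n p → ∀ t j → ∃[ a ] (InS4 (suc n) a × ∃[ q ] + a ≡ + p ℤ.* t ℤ.+ + (p ^ suc j) ℤ.* q)
  approximate (ys , p∣1+s) t j = let x , _ , x⁴≡c = fourth-root-lift c 1≡c j in result x x⁴≡c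
    where
    s : ℕ
    s = sum (map (_^ 4) ys)
    c : ℤ
    c = + p ℤ.* t ℤ.- + s
    1≡c : + p ℤ.∣ + 1 ℤ.- c
    1≡c = subst (+ p ℤ.∣_) (sym (eq (+ s) (+ p ℤ.* t))) (ℤ.∣m∣n⇒∣m-n (ℤ.∣ᵤ⇒∣ {i = + 1 ℤ.+ + s} p∣1+s) (ℤ.∣m⇒∣m*n t ℤ.∣-refl))
      where
      eq : ∀ s z → + 1 ℤ.- (z ℤ.- s) ≡ (+ 1 ℤ.+ s) ℤ.- z
      eq = solve-∀
    result : ∀ x → + (p ^ suc j) ℤ.∣ pow4 x ℤ.- c → ∃[ a ] (InS4 _ a × ∃[ q ] + a ≡ + p ℤ.* t ℤ.+ + (p ^ suc j) ℤ.* q)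
    result x (divides q x⁴-c≡) = ℤ.∣ x ∣ ^ 4 + s , (ℤ.∣ x ∣ ∷ ys , refl) , q , (begin
      + (ℤ.∣ x ∣ ^ 4) ℤ.+ + s                 ≡⟨ cong (ℤ._+ + s) (pos-∣∣^4 x) ⟩
      pow4 x ℤ.+ + s                          ≡⟨ eq (pow4 x) (+ p ℤ.* t) (+ s) ⟩
      + p ℤ.* t ℤ.+ (pow4 x ℤ.- c)            ≡⟨ cong (λ d → + p ℤ.* t ℤ.+ d) (trans x⁴-c≡ (ℤ.*-comm q _)) ⟩
      + p ℤ.* t ℤ.+ + (p ^ suc j) ℤ.* q       ∎)
      where
      open ≡-Reasoning
      eq : ∀ y z s → y ℤ.+ s ≡ z ℤ.+ (y ℤ.- (z ℤ.- s))
      eq = solve-∀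

  -- The fraction u / v is approached by a / b with a ≡ p u and b ≡ p v modulo a high power of p.
  dense : ∀ {n} → Isotropic n p → DenseInQp p (InRS4 (suc n))
  dense {n} isotropic x k = let e , v′ , v≡ , p∤v′ = p-part v {{v-nonZero}} in with-p-part e v′ v≡ p∤v′
    where
    u : ℤ
    u = ↥ x
    v : ℕ
    v = ↧ₙ x
    v-nonZero : NonZero v
    v-nonZero = _
    xv≡u : x ℚ.* ℕ→ℚ v ≡ ℤ→ℚ u
    xv≡u = trans (cong (ℚ._* ℕ→ℚ v) (sym (ℚ.↥p/↧p≡p x))) (/-*-cancel u v)
    with-p-part : ∀ e v′ → v ≡ p ^ e * v′ → ¬ p ℕ.∣ v′ → ∃[ r ] (InRS4 (suc n) r × PAdicSmall p k (r ℚ.- x))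
    with-p-part e v′ v≡ p∤v′ = r , (a , b , a∈S , b∈S , b≢0 , rb≡a) ,
        + p ℤ.* w , b′ * v′ , ∤-* p∤b′ p∤v′ , *-cancelʳ-ℚ M {{M-nonZero}} scaled
      where
      open ≡-Reasoning
      j : ℕ
      -- The product b v has valuation 2e + 1: e from v and e + 1 from b ≡ p v. So N = p^(k + 2e +
      -- 2) leaves p^(k + 1), and the spare p is the factor next to w in the witness.
      j = k + suc (2 * e)
      N : ℤ
      N = + (p ^ suc j)
      near-u = approximate isotropic u j
      near-v = approximate isotropic (+ v) j
      a b : ℕ
      a = proj₁ near-u
      b = proj₁ near-v
      a∈S = proj₁ (proj₂ near-u)
      b∈S = proj₁ (proj₂ near-v)
      qa qb w β : ℤ
      qa = proj₁ (proj₂ (proj₂ near-u))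
      qb = proj₁ (proj₂ (proj₂ near-v))
      w = qa ℤ.* + v ℤ.- u ℤ.* qb
      -- This is b / p^(e + 1). It is congruent to v′ modulo p, hence prime to p.
      β = + v′ ℤ.+ + p ℤ.* (+ (p ^ (k + e)) ℤ.* qb)
      a≡ : + a ≡ + p ℤ.* u ℤ.+ N ℤ.* qa
      a≡ = proj₂ (proj₂ (proj₂ near-u))
      b≡ : + b ≡ + p ℤ.* + v ℤ.+ N ℤ.* qb
      b≡ = proj₂ (proj₂ (proj₂ near-v))
      b′ : ℕ
      b′ = ℤ.∣ β ∣
      N≡ : N ≡ + (p ^ suc e) ℤ.* (+ p ℤ.* + (p ^ (k + e)))
      N≡ = begin
        + (p ^ suc j)                                ≡⟨ cong (λ i → + (p ^ i)) (exponent k e) ⟩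
        + (p ^ (suc e + suc (k + e)))                ≡⟨ cong +_ (ℕ.^-distribˡ-+-* p (suc e) (suc (k + e))) ⟩
        + (p ^ suc e * p ^ suc (k + e))              ≡⟨ ℤ.pos-* (p ^ suc e) (p ^ suc (k + e)) ⟩
        + (p ^ suc e) ℤ.* + (p ^ suc (k + e))        ≡⟨ cong (+ (p ^ suc e) ℤ.*_) (ℤ.pos-* p (p ^ (k + e))) ⟩
        + (p ^ suc e) ℤ.* (+ p ℤ.* + (p ^ (k + e)))  ∎
        where
        exponent : ∀ k e → suc (k + suc (2 * e)) ≡ suc e + suc (k + e)
        exponent = ℕ-Ring.solve-∀
      b≡b′ : b ≡ p ^ suc e * b′
      b≡b′ = trans (cong ℤ.∣_∣ (begin
        + b
          ≡⟨ b≡ ⟩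
        + p ℤ.* + v ℤ.+ N ℤ.* qb
          ≡⟨ cong₂ (λ s t → + p ℤ.* s ℤ.+ t ℤ.* qb) (trans (cong +_ v≡) (ℤ.pos-* (p ^ e) v′)) N≡ ⟩
        + p ℤ.* (+ (p ^ e) ℤ.* + v′) ℤ.+ + (p ^ suc e) ℤ.* (+ p ℤ.* + (p ^ (k + e))) ℤ.* qb
          ≡⟨ cong (ℤ._+ + (p ^ suc e) ℤ.* (+ p ℤ.* + (p ^ (k + e))) ℤ.* qb) (trans (sym (ℤ.*-assoc (+ p) (+ (p ^ e)) (+ v′))) (cong (ℤ._* + v′) (sym (ℤ.pos-* p (p ^ e))))) ⟩
        + (p ^ suc e) ℤ.* + v′ ℤ.+ + (p ^ suc e) ℤ.* (+ p ℤ.* + (p ^ (k + e))) ℤ.* qb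
          ≡⟨ factor (+ (p ^ suc e)) (+ v′) (+ p) (+ (p ^ (k + e))) qb ⟩
        + (p ^ suc e) ℤ.* β ∎)) (ℤ.abs-* (+ (p ^ suc e)) β)
        where
        factor : ∀ m v p s q → m ℤ.* v ℤ.+ m ℤ.* (p ℤ.* s) ℤ.* q ≡ m ℤ.* (v ℤ.+ p ℤ.* (s ℤ.* q))
        factor = solve-∀
      p∤b′ : ¬ p ℕ.∣ b′
      p∤b′ p∣b′ = p∤v′ (ℤ.∣⇒∣ᵤ (ℤ.∣m+n∣n⇒∣m {+ p} {+ v′} (ℤ.∣ᵤ⇒∣ {+ p} {β} p∣b′) (ℤ.∣m⇒∣m*n _ ℤ.∣-refl)))
      b≢0 : b ≢ 0
      b≢0 b≡0 = p∤b′ (subst (p ℕ.∣_) (sym b′≡0) (p ℕ.∣0))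
        where
        b′≡0 : b′ ≡ 0
        b′≡0 = Sum.[ (λ eq → contradiction eq (ℕ.≢-nonZero⁻¹ (p ^ suc e) {{ℕ.m^n≢0 p (suc e)}})) , (λ eq → eq) ]′
          (ℕ.m*n≡0⇒m≡0∨n≡0 (p ^ suc e) (trans (sym b≡b′) b≡0))
      r : ℚ
      r = ℚ._/_ (+ a) b {{ℕ.≢-nonZero b≢0}}
      rb≡a : r ℚ.* ℕ→ℚ b ≡ ℕ→ℚ a
      rb≡a = /-*-cancel (+ a) b {{ℕ.≢-nonZero b≢0}}
      cross : + a ℤ.* + v ≡ u ℤ.* + b ℤ.+ N ℤ.* w
      cross = begin
        + a ℤ.* + v                                     ≡⟨ cong (ℤ._* + v) a≡ ⟩
        (+ p ℤ.* u ℤ.+ N ℤ.* qa) ℤ.* + v                ≡⟨ eq (+ p) u N qa (+ v) qb ⟩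
        u ℤ.* (+ p ℤ.* + v ℤ.+ N ℤ.* qb) ℤ.+ N ℤ.* w    ≡⟨ cong (λ t → u ℤ.* t ℤ.+ N ℤ.* w) (sym b≡) ⟩
        u ℤ.* + b ℤ.+ N ℤ.* w                           ∎
        where
        eq : ∀ p u N qa v qb → (p ℤ.* u ℤ.+ N ℤ.* qa) ℤ.* v ≡ u ℤ.* (p ℤ.* v ℤ.+ N ℤ.* qb) ℤ.+ N ℤ.* (qa ℤ.* v ℤ.- u ℤ.* qb)
        eq = solve-∀
      M : ℕ
      M = p ^ suc (2 * e)
      M-nonZero : NonZero M
      M-nonZero = ℕ.m^n≢0 p (suc (2 * e))
      bv≡ : b′ * v′ * M ≡ b * v
      bv≡ = begin
        b′ * v′ * M                        ≡⟨ cong (b′ * v′ *_) (trans (cong (p ^_) (exponent e)) (ℕ.^-distribˡ-+-* p (suc e) e)) ⟩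
        b′ * v′ * (p ^ suc e * p ^ e)      ≡⟨ eq b′ v′ (p ^ suc e) (p ^ e) ⟩
        p ^ suc e * b′ * (p ^ e * v′)      ≡⟨ sym (cong₂ _*_ b≡b′ v≡) ⟩
        b * v                              ∎
        where
        exponent : ∀ e → suc (2 * e) ≡ suc e + e
        exponent = ℕ-Ring.solve-∀
        eq : ∀ a b c d → a * b * (c * d) ≡ c * a * (d * b)
        eq = ℕ-Ring.solve-∀
      Nw≡ : N ℤ.* w ≡ + (p ^ k) ℤ.* (+ p ℤ.* w) ℤ.* + M
      Nw≡ = begin
        + (p * p ^ j) ℤ.* w                          ≡⟨ cong (ℤ._* w) (trans (cong (λ t → + (p * t)) (ℕ.^-distribˡ-+-* p k (suc (2 * e)))) (trans (ℤ.pos-* p (p ^ k * M)) (cong (+ p ℤ.*_) (ℤ.pos-* (p ^ k) M)))) ⟩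
        + p ℤ.* (+ (p ^ k) ℤ.* + M) ℤ.* w            ≡⟨ eq (+ p) (+ (p ^ k)) (+ M) w ⟩
        + (p ^ k) ℤ.* (+ p ℤ.* w) ℤ.* + M            ∎
        where
        eq : ∀ p q m w → p ℤ.* (q ℤ.* m) ℤ.* w ≡ q ℤ.* (p ℤ.* w) ℤ.* m
        eq = solve-∀
      scaled : (r ℚ.- x) ℚ.* ℕ→ℚ (b′ * v′) ℚ.* ℕ→ℚ M ≡ ℕ→ℚ (p ^ k) ℚ.* ℤ→ℚ (+ p ℤ.* w) ℚ.* ℕ→ℚ M
      scaled = begin
        (r ℚ.- x) ℚ.* ℕ→ℚ (b′ * v′) ℚ.* ℕ→ℚ M          ≡⟨ ℚ.*-assoc (r ℚ.- x) (ℕ→ℚ (b′ * v′)) (ℕ→ℚ M) ⟩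
        (r ℚ.- x) ℚ.* (ℕ→ℚ (b′ * v′) ℚ.* ℕ→ℚ M)        ≡⟨ cong ((r ℚ.- x) ℚ.*_) (trans (sym (ℤ→ℚ-* (+ (b′ * v′)) (+ M))) (cong ℤ→ℚ (sym (ℤ.pos-* (b′ * v′) M)))) ⟩
        (r ℚ.- x) ℚ.* ℕ→ℚ (b′ * v′ * M)                ≡⟨ cong (λ t → (r ℚ.- x) ℚ.* ℕ→ℚ t) bv≡ ⟩
        (r ℚ.- x) ℚ.* ℕ→ℚ (b * v)                      ≡⟨ fraction-approximation {r = r} {x} {+ a} {b} {u} {v} {w} {N} rb≡a xv≡u cross ⟩
        ℤ→ℚ N ℚ.* ℤ→ℚ w                                ≡⟨ sym (ℤ→ℚ-* N w) ⟩
        ℤ→ℚ (N ℤ.* w)                                  ≡⟨ cong ℤ→ℚ Nw≡ ⟩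
        ℤ→ℚ (+ (p ^ k) ℤ.* (+ p ℤ.* w) ℤ.* + M)        ≡⟨ trans (ℤ→ℚ-* (+ (p ^ k) ℤ.* (+ p ℤ.* w)) (+ M)) (cong (ℚ._* ℕ→ℚ M) (ℤ→ℚ-* (+ (p ^ k)) (+ p ℤ.* w))) ⟩
        ℕ→ℚ (p ^ k) ℚ.* ℤ→ℚ (+ p ℤ.* w) ℚ.* ℕ→ℚ M      ∎

-- Anisotropic forms and descent on valuations.

Anisotropic : ℕ → ℕ → Set
Anisotropic m p = (xs : Vec ℕ m) → p ℕ.∣ sum (map (_^ 4) xs) → All (p ℕ.∣_) xs

prime∣^⇒∣ : ∀ {p} → Prime p → ∀ x n → p ℕ.∣ x ^ n → p ℕ.∣ x
prime∣^⇒∣ p-prime x zero    p∣1 = contradiction (ℕ.∣1⇒≡1 p∣1) (ℕ.nonTrivial⇒≢1 {{prime⇒nonTrivial p-prime}})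
prime∣^⇒∣ p-prime x (suc n) p∣  = Sum.[ (λ d → d) , prime∣^⇒∣ p-prime x n ]′ (euclidsLemma x (x ^ n) p-prime p∣)

module NonDensity (p : ℕ) (p-prime : Prime p) {m : ℕ} (anisotropic : Anisotropic m p) where

  instance
    p-nonZero : NonZero p
    p-nonZero = prime⇒nonZero p-prime
    p^4-nonTrivial : ℕ.NonTrivial (p ^ 4)
    p^4-nonTrivial = ℕ.n>1⇒nonTrivial (ℕ.≤-trans (ℕ.nonTrivial⇒n>1 p {{prime⇒nonTrivial p-prime}}) (ℕ.m≤m*n p (p ^ 3) {{ℕ.m^n≢0 p 3}}))

  quotients : ∀ {n} (xs : Vec ℕ n) → All (p ℕ.∣_) xs → Σ (Vec ℕ n) λ ys → sum (map (_^ 4) xs) ≡ p ^ 4 * sum (map (_^ 4) ys)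
  quotients []       []       = [] , sym (ℕ.*-zeroʳ (p ^ 4))
  quotients (x ∷ xs) (d ∷ ds) = let y = ℕ.quotient d ; ys , eq = quotients xs ds in y ∷ ys , (begin
    x ^ 4 + sum (map (_^ 4) xs)                    ≡⟨ cong₂ _+_ (trans (cong (_^ 4) (ℕ.m∣n⇒n≡m*quotient d)) (*-^4 p y)) eq ⟩
    p ^ 4 * y ^ 4 + p ^ 4 * sum (map (_^ 4) ys)    ≡⟨ sym (ℕ.*-distribˡ-+ (p ^ 4) (y ^ 4) _) ⟩
    p ^ 4 * (y ^ 4 + sum (map (_^ 4) ys))          ∎)
    where
    open ≡-Reasoning
    *-^4 : ∀ x y → x * y * (x * y * (x * y * (x * y * 1))) ≡ x * (x * (x * (x * 1))) * (y * (y * (y * (y * 1))))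
    *-^4 = ℕ-Ring.solve-∀

  -- Anisotropy puts a factor p into every entry, so p⁴ comes out of the sum and the quotient has
  -- the same shape.
  divide : ∀ {a} → InS4 m a → p ℕ.∣ a → ∃[ a′ ] (InS4 m a′ × a ≡ p ^ 4 * a′)
  divide (xs , refl) p∣a = let ys , eq = quotients xs (anisotropic xs p∣a) in sum (map (_^ 4) ys) , (ys , refl) , eq

  -- The valuations of a and b are multiples of 4, so they cannot differ by one.
  descent : ∀ {a b d e} → Acc _<_ b → InS4 m a → InS4 m b → b ≢ 0 → ¬ p ℕ.∣ d → ¬ p ℕ.∣ e → a * d ≢ p * (b * e)
  descent {a} {b} {d} {e} (acc rec) a∈S b∈S b≢0 p∤d p∤e eq = step (divide a∈S p∣a)
    where
    open ≡-Reasoning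
    p∣a : p ℕ.∣ a
    p∣a = Sum.[ (λ h → h) , (λ h → contradiction h p∤d) ]′ (euclidsLemma a d p-prime (subst (p ℕ.∣_) (sym eq) (ℕ.m∣m*n (b * e))))
    regroup : ∀ p a d → p * (p * (p * (p * 1))) * a * d ≡ p * (p * (p * p * a * d))
    regroup = ℕ-Ring.solve-∀
    regroup′ : ∀ p b e → p * (p * (p * (p * 1))) * b * e ≡ p * (p * p * (p * (b * e)))
    regroup′ = ℕ-Ring.solve-∀
    step : ∃[ a′ ] (InS4 m a′ × a ≡ p ^ 4 * a′) → _
    step (a′ , a′∈S , a≡) = finish (divide b∈S p∣b)
      where
      be≡ : p * (p * p * a′ * d) ≡ b * e
      be≡ = ℕ.*-cancelˡ-≡ _ _ p (trans (sym (regroup p a′ d)) (trans (cong (_* d) (sym a≡)) eq))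
      p∣b : p ℕ.∣ b
      p∣b = Sum.[ (λ h → h) , (λ h → contradiction h p∤e) ]′ (euclidsLemma b e p-prime (subst (p ℕ.∣_) be≡ (ℕ.m∣m*n (p * p * a′ * d))))
      finish : ∃[ b′ ] (InS4 m b′ × b ≡ p ^ 4 * b′) → _
      -- Both a and b have lost the factor p⁴, so the same equation holds between the quotients,
      -- with a smaller b.
      finish (b′ , b′∈S , b≡) = descent (rec b′<b) a′∈S b′∈S b′≢0 p∤d p∤e
          (ℕ.*-cancelˡ-≡ _ _ (p * p) {{ℕ.m*n≢0 p p}} (ℕ.*-cancelˡ-≡ _ _ p (begin
            p * (p * p * (a′ * d))          ≡⟨ cong (p *_) (sym (ℕ.*-assoc (p * p) a′ d)) ⟩
            p * (p * p * a′ * d)            ≡⟨ be≡ ⟩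
            b * e                           ≡⟨ cong (_* e) b≡ ⟩
            p ^ 4 * b′ * e                  ≡⟨ regroup′ p b′ e ⟩
            p * (p * p * (p * (b′ * e)))    ∎)))
        where
        b′≢0 : b′ ≢ 0
        b′≢0 b′≡0 = b≢0 (trans b≡ (trans (cong (p ^ 4 *_) b′≡0) (ℕ.*-zeroʳ (p ^ 4))))
        b′<b : b′ < b
        b′<b = subst (b′ <_) (trans (ℕ.*-comm b′ (p ^ 4)) (sym b≡)) (ℕ.m<m*n b′ (p ^ 4) {{ℕ.≢-nonZero b′≢0}} (ℕ.nonTrivial⇒n>1 (p ^ 4)))

  -- Precision 2 at the point p is enough: r - p = p² c/d gives r d = p (d + p c) with d + p c prime
  -- to p, so r would have valuation exactly 1.
  not-dense : ¬ DenseInQp p (InRS4 m)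
  not-dense dense =
    let r , (a , b , a∈S , b∈S , b≢0 , rb≡a) , c , d , p∤d , close = dense (ℤ→ℚ (+ p)) 2
    in descent (ℕ.<-wellFounded b) a∈S b∈S b≢0 p∤d (p∤e c d p∤d) (integral r a b c d rb≡a close)
    where
    p∤e : ∀ c d → ¬ p ℕ.∣ d → ¬ p ℕ.∣ ℤ.∣ + d ℤ.+ + p ℤ.* c ∣
    p∤e c d p∤d p∣e = p∤d (ℤ.∣⇒∣ᵤ (ℤ.∣m+n∣n⇒∣m {+ p} {+ d} (ℤ.∣ᵤ⇒∣ {+ p} {+ d ℤ.+ + p ℤ.* c} p∣e) (ℤ.∣m⇒∣m*n c ℤ.∣-refl)))
    integral : ∀ r a b c d → r ℚ.* ℕ→ℚ b ≡ ℕ→ℚ a →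
      (r ℚ.- ℤ→ℚ (+ p)) ℚ.* ℕ→ℚ d ≡ ℕ→ℚ (p ^ 2) ℚ.* ℤ→ℚ c → a * d ≡ p * (b * ℤ.∣ + d ℤ.+ + p ℤ.* c ∣)
    integral r a b c d rb≡a close = begin
      a * d                                             ≡⟨ sym (ℤ.abs-* (+ a) (+ d)) ⟩
      ℤ.∣ + a ℤ.* + d ∣                                 ≡⟨ cong ℤ.∣_∣ (trans (ℤ→ℚ-injective {+ a ℤ.* + d} rational) (trans (cong (λ t → t ℤ.* c ℤ.* + b ℤ.+ + p ℤ.* + d ℤ.* + b) p²≡) (factor (+ p) c (+ b) (+ d)))) ⟩
      ℤ.∣ + p ℤ.* (+ b ℤ.* (+ d ℤ.+ + p ℤ.* c)) ∣       ≡⟨ ℤ.abs-* (+ p) _ ⟩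
      p * ℤ.∣ + b ℤ.* (+ d ℤ.+ + p ℤ.* c) ∣             ≡⟨ cong (p *_) (ℤ.abs-* (+ b) _) ⟩
      p * (b * ℤ.∣ + d ℤ.+ + p ℤ.* c ∣)                 ∎
      where
      open ≡-Reasoning
      open ℚ.+-*-Solver
      p²≡ : + (p ^ 2) ≡ + p ℤ.* + p
      p²≡ = trans (ℤ.pos-* p (p * 1)) (cong (λ n → + p ℤ.* + n) (ℕ.*-identityʳ p))
      factor : ∀ p c b d → p ℤ.* p ℤ.* c ℤ.* b ℤ.+ p ℤ.* d ℤ.* b ≡ p ℤ.* (b ℤ.* (d ℤ.+ p ℤ.* c))
      factor = solve-∀
      rational : ℤ→ℚ (+ a ℤ.* + d) ≡ ℤ→ℚ (+ (p ^ 2) ℤ.* c ℤ.* + b ℤ.+ + p ℤ.* + d ℤ.* + b)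
      rational = begin
        ℤ→ℚ (+ a ℤ.* + d)
          ≡⟨ ℤ→ℚ-* (+ a) (+ d) ⟩
        ℕ→ℚ a ℚ.* ℕ→ℚ d
          ≡⟨ cong (ℚ._* ℕ→ℚ d) (sym rb≡a) ⟩
        r ℚ.* ℕ→ℚ b ℚ.* ℕ→ℚ d
          ≡⟨ solve 4 (λ r b d p → r :* b :* d := (r :- p) :* d :* b :+ p :* d :* b) refl r (ℕ→ℚ b) (ℕ→ℚ d) (ℕ→ℚ p) ⟩
        (r ℚ.- ℕ→ℚ p) ℚ.* ℕ→ℚ d ℚ.* ℕ→ℚ b ℚ.+ ℕ→ℚ p ℚ.* ℕ→ℚ d ℚ.* ℕ→ℚ b
          ≡⟨ cong₂ ℚ._+_ (trans (cong (ℚ._* ℕ→ℚ b) (trans close (sym (ℤ→ℚ-* (+ (p ^ 2)) c)))) (sym (ℤ→ℚ-* (+ (p ^ 2) ℤ.* c) (+ b))))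
                         (trans (cong (ℚ._* ℕ→ℚ b) (sym (ℤ→ℚ-* (+ p) (+ d)))) (sym (ℤ→ℚ-* (+ p ℤ.* + d) (+ b)))) ⟩
        ℤ→ℚ (+ (p ^ 2) ℤ.* c ℤ.* + b) ℚ.+ ℤ→ℚ (+ p ℤ.* + d ℤ.* + b)
          ≡⟨ sym (ℤ→ℚ-+ (+ (p ^ 2) ℤ.* c ℤ.* + b) (+ p ℤ.* + d ℤ.* + b)) ⟩
        ℤ→ℚ (+ (p ^ 2) ℤ.* c ℤ.* + b ℤ.+ + p ℤ.* + d ℤ.* + b) ∎

-- Changing the number of terms, and fourth powers modulo 5 and 29.

anisotropic-pred : ∀ {m p} → Anisotropic (suc m) p → Anisotropic m p
anisotropic-pred anisotropic xs d with anisotropic (0 ∷ xs) d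
... | _ ∷ ds = ds

isotropic-suc : ∀ {n p} → Isotropic n p → Isotropic (suc n) p
isotropic-suc (ys , d) = 0 ∷ ys , d

^4-% : ∀ x p .{{_ : NonZero p}} → x ^ 4 % p ≡ (x % p) ^ 4 % p
^4-% x p = go 4
  where
  open ≡-Reasoning
  go : ∀ n → x ^ n % p ≡ (x % p) ^ n % p
  go zero    = refl
  go (suc n) = begin
    x * x ^ n % p                            ≡⟨ ℕ.%-distribˡ-* x (x ^ n) p ⟩
    (x % p) * (x ^ n % p) % p                ≡⟨ cong₂ (λ s t → s * t % p) (sym (ℕ.m%n%n≡m%n x p)) (go n) ⟩
    (x % p % p) * ((x % p) ^ n % p) % p      ≡⟨ sym (ℕ.%-distribˡ-* (x % p) ((x % p) ^ n) p) ⟩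
    (x % p) * (x % p) ^ n % p                ∎

+-%ʳ : ∀ {p} .{{_ : NonZero p}} m {n k} → n % p ≡ k % p → (m % p + n) % p ≡ (m + k) % p
+-%ʳ {p} m {n} {k} eq = begin
  (m % p + n) % p            ≡⟨ ℕ.%-distribˡ-+ (m % p) n p ⟩
  (m % p % p + n % p) % p    ≡⟨ cong₂ (λ s t → (s + t) % p) (ℕ.m%n%n≡m%n m p) eq ⟩
  (m % p + k % p) % p        ≡⟨ sym (ℕ.%-distribˡ-+ m k p) ⟩
  (m + k) % p                ∎
  where open ≡-Reasoning

residue-∈ : ∀ {p} .{{_ : NonZero p}} {L : List ℕ} → (∀ (i : Fin p) → toℕ i ^ 4 % p ∈ L) → ∀ x → x ^ 4 % p ∈ L
residue-∈ {p} {L} h x = subst (_∈ L) (trans (cong (λ t → t ^ 4 % p) (Finₚ.toℕ-fromℕ< (ℕ.m%n<n x p))) (sym (^4-% x p))) (h (fromℕ< (ℕ.m%n<n x p)))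

residue≡0⇒∣ : ∀ {p} .{{_ : NonZero p}} → Prime p → ∀ x → x ^ 4 % p ≡ 0 → p ℕ.∣ x
residue≡0⇒∣ {p} p-prime x eq = prime∣^⇒∣ p-prime x 4 (ℕ.m%n≡0⇒n∣m (x ^ 4) p eq)

-- The nonzero entries form the trivial group modulo 5 and the group of order 7 generated by 7
-- modulo 29. Working with residues leaves 2⁴ and 8³ combinations to check.
biquadratic-residues₅ biquadratic-residues₂₉ : List ℕ
biquadratic-residues₅ = 0 ∷ 1 ∷ []
biquadratic-residues₂₉ = 0 ∷ 1 ∷ 7 ∷ 16 ∷ 20 ∷ 23 ∷ 24 ∷ 25 ∷ []

-- Each term is 0 or 1 modulo 5, and four such terms add up to at most 4.
anisotropic₅ : Anisotropic 4 5
anisotropic₅ (x ∷ y ∷ z ∷ t ∷ []) d =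
  let x≡0 , y≡0 , z≡0 , t≡0 = All.lookup (All.lookup (All.lookup (All.lookup check (∈L x)) (∈L y)) (∈L z)) (∈L t) sum%5
  in residue≡0⇒∣ prime₅ x x≡0 ∷ residue≡0⇒∣ prime₅ y y≡0 ∷ residue≡0⇒∣ prime₅ z z≡0 ∷ residue≡0⇒∣ prime₅ t t≡0 ∷ []
  where
  L : List ℕ
  L = biquadratic-residues₅
  prime₅ : Prime 5
  prime₅ = from-yes (prime? 5)
  ∈L : ∀ x → x ^ 4 % 5 ∈ L
  ∈L = residue-∈ (from-yes (Finₚ.all? (λ (i : Fin 5) → _∈?_ ℕ._≟_ (toℕ i ^ 4 % 5) L)))
  check : All.All (λ a → All.All (λ b → All.All (λ c → All.All (λ d → (a + (b + (c + (d + 0)))) % 5 ≡ 0 → a ≡ 0 × b ≡ 0 × c ≡ 0 × d ≡ 0) L) L) L) L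
  check = from-yes (All.all? (λ a → All.all? (λ b → All.all? (λ c → All.all? (λ d →
    ((a + (b + (c + (d + 0)))) % 5 ℕ.≟ 0) →-dec ((a ℕ.≟ 0) ×-dec ((b ℕ.≟ 0) ×-dec ((c ℕ.≟ 0) ×-dec (d ℕ.≟ 0))))) L) L) L) L)
  sum%5 : (x ^ 4 % 5 + (y ^ 4 % 5 + (z ^ 4 % 5 + (t ^ 4 % 5 + 0)))) % 5 ≡ 0
  sum%5 = trans (+-%ʳ (x ^ 4) (+-%ʳ (y ^ 4) (+-%ʳ (z ^ 4) (+-%ʳ (t ^ 4) {0} {0} refl)))) (ℕ.n∣m⇒m%n≡0 _ 5 d)

anisotropic₂₉ : Anisotropic 3 29
anisotropic₂₉ (x ∷ y ∷ z ∷ []) d =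
  let x≡0 , y≡0 , z≡0 = All.lookup (All.lookup (All.lookup check (∈L x)) (∈L y)) (∈L z) sum%29
  in residue≡0⇒∣ prime₂₉ x x≡0 ∷ residue≡0⇒∣ prime₂₉ y y≡0 ∷ residue≡0⇒∣ prime₂₉ z z≡0 ∷ []
  where
  L : List ℕ
  L = biquadratic-residues₂₉
  prime₂₉ : Prime 29
  prime₂₉ = from-yes (prime? 29)
  ∈L : ∀ x → x ^ 4 % 29 ∈ L
  ∈L = residue-∈ (from-yes (Finₚ.all? (λ (i : Fin 29) → _∈?_ ℕ._≟_ (toℕ i ^ 4 % 29) L)))
  check : All.All (λ a → All.All (λ b → All.All (λ c → (a + (b + (c + 0))) % 29 ≡ 0 → a ≡ 0 × b ≡ 0 × c ≡ 0) L) L) L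
  check = from-yes (All.all? (λ a → All.all? (λ b → All.all? (λ c →
    ((a + (b + (c + 0))) % 29 ℕ.≟ 0) →-dec ((a ℕ.≟ 0) ×-dec ((b ℕ.≟ 0) ×-dec (c ℕ.≟ 0)))) L) L) L)
  sum%29 : (x ^ 4 % 29 + (y ^ 4 % 29 + (z ^ 4 % 29 + 0))) % 29 ≡ 0
  sum%29 = trans (+-%ʳ (x ^ 4) (+-%ʳ (y ^ 4) (+-%ʳ (z ^ 4) {0} {0} refl))) (ℕ.n∣m⇒m%n≡0 _ 29 d)

-- In the last two cases the parameter exhibits the odd number f = 2k + 1 with p - 1 = 4f or p - 1 =
-- 2f, which serves as the exponent of ψ.
data OddClass (p : ℕ) : Set where
  1mod8 : ∀ q → p ≡ suc (8 * q) → OddClass p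
  5mod8 : ∀ k → p ≡ suc (4 * suc (2 * k)) → OddClass p
  3mod4 : ∀ k → p ≡ suc (2 * suc (2 * k)) → OddClass p

oddClass : ∀ {p} → Prime p → 2 < p → OddClass p
oddClass {p} p-prime 2<p = go (p % 8) (p ℕ./ 8) (ℕ.m%n<n p 8) (ℕ.m≡m%n+[m/n]*n p 8)
  where
  even : ∀ n → p ≢ 2 * n
  even n eq = Sum.[ (λ ()) , (λ 2≡p → ℕ.<-irrefl 2≡p 2<p) ]′ (prime⇒irreducible p-prime (ℕ.divides n (trans eq (ℕ.*-comm 2 n))))
  go : ∀ r q → r < 8 → p ≡ r + q * 8 → OddClass p
  go 0 q _ eq = contradiction (trans eq (shape q)) (even (q * 4))
    where
    shape : ∀ q → q * 8 ≡ 2 * (q * 4)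
    shape = ℕ-Ring.solve-∀
  go 1 q _ eq = 1mod8 q (trans eq (cong suc (ℕ.*-comm q 8)))
  go 2 q _ eq = contradiction (trans eq (shape q)) (even (1 + q * 4))
    where
    shape : ∀ q → 2 + q * 8 ≡ 2 * (1 + q * 4)
    shape = ℕ-Ring.solve-∀
  go 3 q _ eq = 3mod4 (2 * q) (trans eq (shape q))
    where
    shape : ∀ q → 3 + q * 8 ≡ suc (2 * suc (2 * (2 * q)))
    shape = ℕ-Ring.solve-∀
  go 4 q _ eq = contradiction (trans eq (shape q)) (even (2 + q * 4))
    where
    shape : ∀ q → 4 + q * 8 ≡ 2 * (2 + q * 4)
    shape = ℕ-Ring.solve-∀
  go 5 q _ eq = 5mod8 q (trans eq (shape q))
    where
    shape : ∀ q → 5 + q * 8 ≡ suc (4 * suc (2 * q))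
    shape = ℕ-Ring.solve-∀
  go 6 q _ eq = contradiction (trans eq (shape q)) (even (3 + q * 4))
    where
    shape : ∀ q → 6 + q * 8 ≡ 2 * (3 + q * 4)
    shape = ℕ-Ring.solve-∀
  go 7 q _ eq = 3mod4 (suc (2 * q)) (trans eq (shape q))
    where
    shape : ∀ q → 7 + q * 8 ≡ suc (2 * suc (2 * suc (2 * q)))
    shape = ℕ-Ring.solve-∀
  go (suc (suc (suc (suc (suc (suc (suc (suc _)))))))) _ (s≤s (s≤s (s≤s (s≤s (s≤s (s≤s (s≤s (s≤s ())))))))) _

-- The four equivalences and density results assembled.

module Conclusion (p : ℕ) (p-prime : Prime p) (2<p : 2 < p) where
  open Solutions p p-prime

  half : ∃[ l ] p ≡ suc (2 * l)
  half = go (oddClass p-prime 2<p)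
    where
    go : OddClass p → ∃[ l ] p ≡ suc (2 * l)
    go (1mod8 q eq) = 4 * q , trans eq (cong suc (ℕ.*-assoc 2 4 q))
    go (5mod8 k eq) = 2 * suc (2 * k) , trans eq (cong suc (ℕ.*-assoc 2 2 (suc (2 * k))))
    go (3mod4 k eq) = suc (2 * k) , eq

  dense : ∀ {n} → Isotropic n p → DenseInQp p (InRS4 (suc n))
  dense = Density.dense p p-prime (proj₁ half) (proj₂ half)

  not-dense : ∀ {m} → Anisotropic m p → ¬ DenseInQp p (InRS4 m)
  not-dense = NonDensity.not-dense p p-prime

  isotropic-1 : ∀ q → p ≡ suc (8 * q) → Isotropic 1 p
  isotropic-1 zero    eq = contradiction (subst (2 <_) eq 2<p) λ { (s≤s ()) }
  isotropic-1 (suc q) eq = isotropic-1mod8 q eq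

  isotropic-2 : p ≢ 5 → p ≢ 29 → Isotropic 2 p
  isotropic-2 p≢5 p≢29 = go (oddClass p-prime 2<p)
    where
    go : OddClass p → Isotropic 2 p
    go (1mod8 q eq) = isotropic-suc (isotropic-1 q eq)
    go (5mod8 k eq) = isotropic-5mod8 k eq p≢5 p≢29
    go (3mod4 k eq) = isotropic-3mod4 k eq

  isotropic-3 : p ≢ 5 → Isotropic 3 p
  isotropic-3 p≢5 = go (p ℕ.≟ 29)
    where
    go : Dec (p ≡ 29) → Isotropic 3 p
    -- 5394 = 1 + 1⁴ + 6⁴ + 8⁴ = 29 · 186; modulo 29 this is 1 + 1 + 20 + 7.
    go (yes p≡29) = 1 ∷ 6 ∷ 8 ∷ [] , subst (ℕ._∣ 5394) (sym p≡29) (ℕ.divides 186 refl)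
    go (no p≢29)  = isotropic-suc (isotropic-2 p≢5 p≢29)

  isotropic-4+ : ∀ t → Isotropic (t + 4) p
  isotropic-4+ (suc t) = isotropic-suc (isotropic-4+ t)
  isotropic-4+ zero    = go (p ℕ.≟ 5)
    where
    go : Dec (p ≡ 5) → Isotropic 4 p
    go (yes p≡5) = 1 ∷ 1 ∷ 1 ∷ 1 ∷ [] , subst (ℕ._∣ 5) (sym p≡5) ℕ.∣-refl
    go (no p≢5)  = isotropic-suc (isotropic-3 p≢5)

  anisotropic-2 : ∀ k j → 4 * suc (2 * k) ≡ (p ∸ 1) * j → Anisotropic 2 p
  anisotropic-2 k j eq (x ∷ y ∷ []) d =
    no-sum-of-two 2<p k j eq y x (subst (p ℕ.∣_) (ℕ.+-comm (x ^ 4) (y ^ 4)) d′) ∷ no-sum-of-two 2<p k j eq x y d′ ∷ []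
    where
    d′ : p ℕ.∣ x ^ 4 + y ^ 4
    d′ = subst (λ t → p ℕ.∣ x ^ 4 + t) (ℕ.+-identityʳ (y ^ 4)) d

  dense-2⇒ : DenseInQp p (InRS4 2) → p % 8 ≡ 1
  dense-2⇒ h = go (oddClass p-prime 2<p)
    where
    go : OddClass p → p % 8 ≡ 1
    go (1mod8 q eq) = trans (cong (_% 8) (trans eq (cong suc (ℕ.*-comm 8 q)))) (ℕ.[m+kn]%n≡m%n 1 q 8)
    -- Here 4f = p - 1, so the multiplier is 1; for p ≡ 3 (mod 4) it is 2, as 4f = 2 (p - 1).
    go (5mod8 k eq) = contradiction h (not-dense (anisotropic-2 k 1 (trans (sym (ℕ.*-identityʳ _)) (cong (λ n → (n ∸ 1) * 1) (sym eq)))))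
    go (3mod4 k eq) = contradiction h (not-dense (anisotropic-2 k 2 (trans (shape (suc (2 * k))) (cong (λ n → (n ∸ 1) * 2) (sym eq)))))
      where
      shape : ∀ f → 4 * f ≡ 2 * f * 2
      shape = ℕ-Ring.solve-∀

  dense-2⇐ : p % 8 ≡ 1 → DenseInQp p (InRS4 2)
  dense-2⇐ eq = dense (isotropic-1 (p ℕ./ 8) (begin
    p                          ≡⟨ ℕ.m≡m%n+[m/n]*n p 8 ⟩
    p % 8 + p ℕ./ 8 * 8        ≡⟨ cong₂ _+_ eq (ℕ.*-comm (p ℕ./ 8) 8) ⟩
    suc (8 * (p ℕ./ 8))        ∎))
    where open ≡-Reasoning

  dense-3⇒ : DenseInQp p (InRS4 3) → p ≢ 5 × p ≢ 29
  dense-3⇒ h = (λ p≡5 → not-dense (subst (Anisotropic 3) (sym p≡5) (anisotropic-pred anisotropic₅)) h) ,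
               (λ p≡29 → not-dense (subst (Anisotropic 3) (sym p≡29) anisotropic₂₉) h)

  dense-4⇒ : DenseInQp p (InRS4 4) → p ≢ 5
  dense-4⇒ h p≡5 = not-dense (subst (Anisotropic 4) (sym p≡5) anisotropic₅) h

  dense-5+ : ∀ m → 5 ≤ m → DenseInQp p (InRS4 m)
  dense-5+ m 5≤m = subst (DenseInQp p ∘ InRS4) (trans (sym (ℕ.+-suc (m ∸ 5) 4)) (ℕ.m∸n+n≡m 5≤m)) (dense (isotropic-4+ (m ∸ 5)))

theorem1p13 : (p : ℕ) → Prime p → 2 < p →
    (DenseInQp p (InRS4 2) ⇔ p % 8 ≡ 1)
    × (DenseInQp p (InRS4 3) ⇔ (p ≢ 5 × p ≢ 29))
    × (DenseInQp p (InRS4 4) ⇔ p ≢ 5)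
    × ((m : ℕ) → 5 ≤ m → DenseInQp p (InRS4 m))
theorem1p13 p p-prime 2<p =
    mk⇔ dense-2⇒ dense-2⇐
  , mk⇔ dense-3⇒ (λ (p≢5 , p≢29) → dense (isotropic-2 p≢5 p≢29))
  , mk⇔ dense-4⇒ (λ p≢5 → dense (isotropic-3 p≢5))
  , dense-5+
  where open Conclusion p p-prime 2<p
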